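{- Let $W'$ be a folding of a Coxeter group $W$. If $W$ is futuristic, then $W'$ is futuristic.
   Context: Let $(W,S)$ be a Coxeter system with $S=\{s_i:i\in I\}$, $I$ a finite index set; $m(i,i')$ is the order of $s_is_{i'}$. The Coxeter graph $\Gamma_W$ has vertex set $I$, with distinct $i,i'$ joined by an edge labeled $m(i,i')$ whenever $m(i,i')\ge 3$. Folding: let $\sigma\colon I\to I$ be an automorphism of the edge-labeled graph $\Gamma_W$ such that each orbit (cycle) of $\sigma$ is an independent set (pairwise nonadjacent vertices) of $\Gamma_W$. Let $I'$ be the set of orbits of $\sigma$. The folding of $W$ along $\sigma$ is the Coxeter group $W'$ with Coxeter system $(W',S')$, $S'=\{s_{\mathfrak o}:\mathfrak o\in I'\}$, where for all $\mathfrak o,\mathfrak o'\in I'$ the order $m(\mathfrak o,\mathfrak o')$ of $s_{\mathfrak o}s_{\mathfrak o'}$ in $W'$ is defined to be the order of $\prod_{i\in\mathfrak o}s_i\prod_{i'\in\mathfrak o'}s_{i'}$ in $W$. The root space is $V=\mathbb R^I$ with standard basis the simple roots $\{\alpha_i:i\in I\}$ and symmetric bilinear form $B(\alpha_i,\alpha_{i'})=-\cos(\pi/m(i,i'))$ (and $-1$ if $m(i,i')=\infty$). $W$ acts on $V$ by $s_i\beta=\beta-2B(\beta,\alpha_i)\alpha_i$. The root system is $\Phi=\{w\alpha_i:w\in W,i\in I\}=\Phi^+\sqcup\Phi^-$, where $\Phi^+$ are the roots that are nonnegative combinations of simple roots and $\Phi^-=-\Phi^+$. For $\beta\in\Phi$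 the half-space $H_\beta^+$ is $\{w\in W:w\beta\in\Phi^+\}$. A subset of $W$ is convex if it is an intersection of half-spaces (the empty intersection being $W$). For a nonempty convex set $\mathscr L\subseteq W$ let $\mathrm R(\mathscr L)=\{\beta\in\Phi:\mathscr L\subseteq H_\beta^+\}$. For $i\in I$, the toggle $\tau_i\colon W\to W$ is defined by $\tau_i(u)=u$ if $u^{ -1}\alpha_i\in\mathrm R(\mathscr L)$ and $\tau_i(u)=s_iu$ otherwise. A Coxeter element is a product $c=s_{i_n}\cdots s_{i_1}$ where $i_1,\ldots,i_n$ is an ordering of $I$ (each element once); $\mathrm{Pro}_c=\tau_{i_n}\cdots\tau_{i_1}$ (composition), which depends only on $c$ and $\mathscr L$. The set $\mathscr L$ is heavy with respect to $c$ if every periodic point of $\mathrm{Pro}_c$ (i.e. every $u\in W$ with $\mathrm{Pro}_c^K(u)=u$ for some $K\ge 1$) lies in $\mathscr L$. The Coxeter group $W$ is futuristic if every nonempty convex subset of $W$ is heavy with respect to every Coxeter element of $W$. -}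

module Defs where

open import Algebra.Bundles using (CommutativeRing; Group)
import Algebra.Definitions.RawMonoid as RawMonoidDefs
open import Axiom.ExcludedMiddle using (ExcludedMiddle)
open import Data.Bool.Base using (if_then_else_)
open import Data.Fin.Base using (Fin)
open import Data.Fin.Permutation using (Permutation′; _⟨$⟩ʳ_)
open import Data.Fin.Properties using (_≟_)
open import Data.List.Base
  using (List; []; _∷_; _++_; concat; replicate; reverse; foldr; filter; allFin)
open import Data.List.Properties
  using (++-assoc; ++-identityʳ; reverse-++; reverse-involutive; unfold-reverse)
open import Data.List.Relation.Binary.Permutation.Propositional using (_↭_)
open import Data.Nat.Base as ℕ using (ℕ; suc)
open import Data.Nat.GeneralisedArithmetic using (fold)
open import Data.Product.Base using (Σ-syntax; ∃; ∃-syntax; _×_; _,_)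
open import Data.Vec.Functional using (Vector)
open import Function.Bundles using (_⇔_)
open import Level using (0ℓ)
open import Relation.Binary.Construct.Add.Supremum.NonStrict ℕ._≤_ using (_≤⁺_)
open import Relation.Binary.Core using (Rel)
open import Relation.Binary.PropositionalEquality
  using (_≡_; _≢_; refl; sym; trans; cong; cong₂; subst)
open import Relation.Binary.Structures using (IsTotalOrder)
open import Relation.Nullary.Construct.Add.Supremum using (_⁺)
  renaming ([_] to fin; ⊤⁺ to ∞)
open import Relation.Nullary.Decidable.Core using (does)
open import Relation.Nullary.Negation.Core using (¬_)

-- A Dedekind-complete ordered field, equipped with π, cos and sin.
-- A complete ordered field is unique up to isomorphism.  The axioms for
-- π, cos and sin are those of Apostol (Calculus I, §2.5), together with
-- 0 < π; on the reals they have the usual number π and the usual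
-- functions as their only solution, so quantifying over Reals is
-- quantifying over copies of ℝ.  Equality is a setoid equality,
-- since there are no quotient types, and _⁻¹ is total with an
-- unspecified value at 0.

record Reals : Set₁ where
  infix  8 _⁻¹
  infix  4 _≤_ _<_
  infixl 7 _/ℕ_
  field
    commutativeRing : CommutativeRing 0ℓ 0ℓ

  open CommutativeRing commutativeRing public
    using (_≈_; _+_; _*_; -_; _-_; 0#; 1#; +-rawMonoid; setoid)
    renaming (Carrier to ℝ)

  field
    _⁻¹          : ℝ → ℝ
    ⁻¹-cong      : ∀ {x y} → x ≈ y → x ⁻¹ ≈ y ⁻¹
    *-inverseʳ   : ∀ x → ¬ (x ≈ 0#) → x * x ⁻¹ ≈ 1#
    0≉1          : ¬ (0# ≈ 1#)

    _≤_          : Rel ℝ 0ℓ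
    isTotalOrder : IsTotalOrder _≈_ _≤_
    +-monoˡ-≤    : ∀ z {x y} → x ≤ y → x + z ≤ y + z
    *-nonNeg     : ∀ {x y} → 0# ≤ x → 0# ≤ y → 0# ≤ x * y

  _<_ : Rel ℝ 0ℓ
  x < y = x ≤ y × ¬ (x ≈ y)

  UpperBound : (ℝ → Set) → ℝ → Set
  UpperBound S b = ∀ x → S x → x ≤ b

  field
    complete : (S : ℝ → Set) → ∃ S → ∃ (UpperBound S) →
               ∃[ s ] UpperBound S s × (∀ b → UpperBound S b → s ≤ b)

  _/ℕ_ : ℝ → ℕ → ℝ
  x /ℕ k = x * (RawMonoidDefs._×_ +-rawMonoid k 1#) ⁻¹

  field
    π          : ℝ
    cos sin    : ℝ → ℝ
    cos-cong   : ∀ {x y} → x ≈ y → cos x ≈ cos y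
    sin-cong   : ∀ {x y} → x ≈ y → sin x ≈ sin y
    0<π        : 0# < π
    cos[0]     : cos 0# ≈ 1#
    sin[π/2]   : sin (π /ℕ 2) ≈ 1#
    cos[π]     : cos π ≈ - 1#
    cos[y-x]   : ∀ x y → cos (y - x) ≈ cos y * cos x + sin y * sin x
    -- 0 < cos x < sin x / x < 1 / cos x, with denominators cleared
    0<cos      : ∀ x → 0# < x → x < π /ℕ 2 → 0# < cos x
    x*cos<sin  : ∀ x → 0# < x → x < π /ℕ 2 → x * cos x < sin x
    sin*cos<x  : ∀ x → 0# < x → x < π /ℕ 2 → sin x * cos x < x

ℕ∞ : Set
ℕ∞ = ℕ ⁺

record CoxeterMatrix (n : ℕ) : Set where
  field
    m           : Fin n → Fin n → ℕ∞
    diagonal    : ∀ i → m i i ≡ fin 1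
    symmetric   : ∀ i j → m i j ≡ m j i
    offDiagonal : ∀ i j → i ≢ j → fin 2 ≤⁺ m i j

  -- Edge i j ℓ: in the Coxeter graph, i and j are joined by an edge
  -- with label ℓ.
  Edge : Fin n → Fin n → ℕ∞ → Set
  Edge i j ℓ = i ≢ j × m i j ≡ ℓ × fin 3 ≤⁺ ℓ

  Adjacent : Fin n → Fin n → Set
  Adjacent i j = ∃[ ℓ ] Edge i j ℓ

-- The word i₁ ∷ … ∷ iₖ ∷ [] denotes the product s_{i₁} ⋯ s_{iₖ}.

Word : ℕ → Set
Word n = List (Fin n)

infixr 8 _^_

_^_ : ∀ {n} → Word n → ℕ → Word n
w ^ k = concat (replicate k w)

module _ {n : ℕ} (M : CoxeterMatrix n) where
  open CoxeterMatrix M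

  -- Equality in W = ⟨ s_i ∣ (s_i s_j)^{m(i,j)} = 1 whenever m(i,j) < ∞ ⟩.
  -- The relation s_i s_i = 1 is the case i = j.
  data WordEq : Rel (Word n) 0ℓ where
    relator  : ∀ i j {k} → m i j ≡ fin k → WordEq ((i ∷ j ∷ []) ^ k) []
    ≋-refl   : ∀ {u} → WordEq u u
    ≋-sym    : ∀ {u v} → WordEq u v → WordEq v u
    ≋-trans  : ∀ {u v w} → WordEq u v → WordEq v w → WordEq u w
    ++-cong  : ∀ {u u′ v v′} → WordEq u u′ → WordEq v v′ →
               WordEq (u ++ v) (u′ ++ v′)

  private
    ≡⇒≋ : ∀ {u v} → u ≡ v → WordEq u v
    ≡⇒≋ refl = ≋-refl

    generator-involutive : ∀ i → WordEq (i ∷ i ∷ []) []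
    generator-involutive i = relator i i (diagonal i)

    inverseˡ : ∀ u → WordEq (reverse u ++ u) []
    inverseˡ []      = ≋-refl
    inverseˡ (i ∷ u) = ≋-trans
      (≡⇒≋ (trans (cong (_++ i ∷ u) (unfold-reverse i u))
                  (++-assoc (reverse u) (i ∷ []) (i ∷ u))))
      (≋-trans (++-cong (≋-refl {reverse u})
                        (++-cong (generator-involutive i) (≋-refl {u})))
               (inverseˡ u))

    inverseʳ : ∀ u → WordEq (u ++ reverse u) []
    inverseʳ u = subst (λ v → WordEq (v ++ reverse u) [])
                       (reverse-involutive u) (inverseˡ (reverse u))

    alternating-reverse : ∀ (i j : Fin n) k →
      reverse ((i ∷ j ∷ []) ^ k) ≡ (j ∷ i ∷ []) ^ k
    alternating-reverse i j ℕ.zero  = refl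
    alternating-reverse i j (suc k) = trans
      (reverse-++ (i ∷ j ∷ []) ((i ∷ j ∷ []) ^ k))
      (trans (cong (_++ j ∷ i ∷ []) (alternating-reverse i j k))
             (commute k))
      where
      commute : ∀ k → (j ∷ i ∷ []) ^ k ++ j ∷ i ∷ [] ≡ j ∷ i ∷ (j ∷ i ∷ []) ^ k
      commute ℕ.zero  = refl
      commute (suc k) = cong (λ w → j ∷ i ∷ w) (commute k)

    reverse-cong : ∀ {u v} → WordEq u v → WordEq (reverse u) (reverse v)
    reverse-cong (relator i j {k} e) =
      ≋-trans (≡⇒≋ (alternating-reverse i j k))
              (relator j i (trans (symmetric j i) e))
    reverse-cong ≋-refl        = ≋-refl
    reverse-cong (≋-sym p)     = ≋-sym (reverse-cong p)
    reverse-cong (≋-trans p q) = ≋-trans (reverse-cong p) (reverse-cong q)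
    reverse-cong (++-cong {u} {u′} {v} {v′} p q) =
      ≋-trans (≡⇒≋ (reverse-++ u v))
      (≋-trans (++-cong (reverse-cong q) (reverse-cong p))
               (≡⇒≋ (sym (reverse-++ u′ v′))))

  coxeterGroup : Group 0ℓ 0ℓ
  coxeterGroup = record
    { Carrier = Word n
    ; _≈_     = WordEq
    ; _∙_     = _++_
    ; ε       = []
    ; _⁻¹     = reverse
    ; isGroup = record
      { isMonoid = record
        { isSemigroup = record
          { isMagma = record
            { isEquivalence = record
              { refl = ≋-refl ; sym = ≋-sym ; trans = ≋-trans }
            ; ∙-cong = ++-cong }
          ; assoc = λ u v w → ≡⇒≋ (++-assoc u v w) }
        ; identity = (λ _ → ≋-refl) , λ u → ≡⇒≋ (++-identityʳ u) }
      ; inverse = inverseˡ , inverseʳ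
      ; ⁻¹-cong = reverse-cong } }

  HasOrder : Word n → ℕ∞ → Set
  HasOrder w (fin k) = 1 ℕ.≤ k × WordEq (w ^ k) [] ×
                       (∀ l → 1 ℕ.≤ l → l ℕ.< k → ¬ WordEq (w ^ l) [])
  HasOrder w ∞       = ∀ l → 1 ℕ.≤ l → ¬ WordEq (w ^ l) []

  IsOrdering : List (Fin n) → Set
  IsOrdering is = is ↭ allFin n

  IsCoxeterElement : Word n → Set
  IsCoxeterElement c = ∃[ is ] IsOrdering is × WordEq c is

-- The orbit set I′ is enumerated by Fin n′ through the quotient map orb.
-- An orbit is independent, so its generators commute and the order of
-- the factors in orbitProduct is immaterial.

orbitProduct : ∀ {n n′} → (Fin n → Fin n′) → Fin n′ → Word n
orbitProduct {n} orb o = filter (λ i → orb i ≟ o) (allFin n)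

record IsFolding {n n′ : ℕ} (M : CoxeterMatrix n) (M′ : CoxeterMatrix n′) : Set where
  private
    module M  = CoxeterMatrix M
    module M′ = CoxeterMatrix M′
  field
    σ            : Permutation′ n
    automorphism : ∀ i j ℓ → M.Edge i j ℓ ⇔ M.Edge (σ ⟨$⟩ʳ i) (σ ⟨$⟩ʳ j) ℓ
    orb          : Fin n → Fin n′
    surjective   : ∀ o → ∃[ i ] orb i ≡ o
    orbits       : ∀ i j → orb i ≡ orb j ⇔ (∃[ t ] fold i (σ ⟨$⟩ʳ_) t ≡ j)
    independent  : ∀ i j → orb i ≡ orb j → ¬ M.Adjacent i j
    order        : ∀ o o′ →
      HasOrder M (orbitProduct orb o ++ orbitProduct orb o′) (M′.m o o′)

-- Excluded middle is used to decide the case distinction in a toggle.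

module _ (em : ExcludedMiddle 0ℓ) (R : Reals) {n : ℕ} (M : CoxeterMatrix n) where
  open Reals R
  open CoxeterMatrix M
  open Group (coxeterGroup M) using ()
    renaming (Carrier to W; _≈_ to _≋_; _⁻¹ to _⁻¹ᵂ; _∙_ to _∙_)
  open RawMonoidDefs +-rawMonoid using (sum)

  V : Set
  V = Vector ℝ n

  infix 4 _≈ⱽ_

  _≈ⱽ_ : Rel V 0ℓ
  β ≈ⱽ γ = ∀ j → β j ≈ γ j

  α : Fin n → V
  α i j = if does (i ≟ j) then 1# else 0#

  Bα : Fin n → Fin n → ℝ
  Bα i j with m i j
  ... | fin k = - cos (π /ℕ k)
  ... | ∞     = - 1#

  B : V → V → ℝ
  B β γ = sum λ i → sum λ j → β i * γ j * Bα i j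

  reflect : Fin n → V → V
  reflect i β j = β j - (1# + 1#) * B β (α i) * α i j

  infixr 7 _•_

  _•_ : W → V → V
  w • β = foldr reflect β w

  IsRoot : V → Set
  IsRoot β = Σ[ w ∈ W ] ∃[ i ] β ≈ⱽ w • α i

  IsPositiveRoot : V → Set
  IsPositiveRoot β = IsRoot β × (∀ j → 0# ≤ β j)

  HalfSpace : V → W → Set
  HalfSpace β w = IsPositiveRoot (w • β)

  IsConvex : (W → Set) → Set₁
  IsConvex L = Σ[ A ∈ (V → Set) ]
    (∀ β → A β → IsRoot β) × (∀ w → L w ⇔ (∀ β → A β → HalfSpace β w))

  RootsOf : (W → Set) → V → Set
  RootsOf L β = IsRoot β × (∀ w → L w → HalfSpace β w)

  toggle : (W → Set) → Fin n → W → W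
  toggle L i u =
    if does (em {RootsOf L (u ⁻¹ᵂ • α i)}) then u else (i ∷ []) ∙ u

  -- For is = i_n ∷ … ∷ i_1 ∷ [], this is τ_{i_n} ⋯ τ_{i_1}; the Coxeter
  -- element s_{i_n} ⋯ s_{i_1} is the word is itself.
  Pro : (W → Set) → List (Fin n) → W → W
  Pro L is u = foldr (toggle L) u is

  -- Pro_c does not depend on the ordering chosen to represent c, so
  -- quantifying over all of them is harmless.
  IsHeavy : (W → Set) → W → Set
  IsHeavy L c = ∀ is → IsOrdering M is → c ≋ is →
    ∀ u → (∃[ K ] 1 ℕ.≤ K × fold u (Pro L is) K ≋ u) → L u

  IsFuturistic : Set₁
  IsFuturistic = ∀ (L : W → Set) → ∃ L → IsConvex L →
    ∀ c → IsCoxeterElement M c → IsHeavy L c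

module Submission where

-- Let φ : W′ → W send s_o to the product of the s_i with i ∈ o.  For x ∈ W′ and i ∈ o, the root
-- φ(x) α_i is positive exactly when x α_o is.  Both signs are governed by whether x s_o is longer
-- than x in W′, by the usual reduction to dihedral subgroups.  In the folded case the dihedral step
-- uses no geometry of W′: if an alternating word in o and o′ first sends α_i to a negative root
-- after a prefix g, then g permutes the simple roots of the two orbits (this uses σ), so it
-- conjugates their products into each other; thus two alternating words agree in W, contradicting
-- the order of (∏ s_i)(∏ s_j).
--
-- Given a convex L′ ⊆ W′, let L be the intersection of the half-spaces containing φ(L′).  By the
-- sign comparison, L′ = φ⁻¹(L), and toggling at o in W′ corresponds under φ to toggling at all
-- i ∈ o in W.  Hence φ intertwines promotion and maps periodic points to periodic points.

open import Defs hiding (V; _≈ⱽ_; α; Bα; B; reflect; _•_)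
open import Algebra.Bundles using (CommutativeRing; Group; RawRing)
import Algebra.Properties.AbelianGroup
import Algebra.Properties.Group
import Algebra.Properties.Ring
import Algebra.Properties.Semiring.Mult
import Algebra.Properties.Semiring.Mult.TCOptimised
import Algebra.Properties.Semiring.Sum
import Algebra.Solver.Ring
open import Algebra.Solver.Ring.AlmostCommutativeRing
  using (_-Raw-AlmostCommutative⟶_; fromCommutativeRing)
import Algebra.Solver.Ring.NaturalCoefficients.Default
open import Axiom.ExcludedMiddle using (ExcludedMiddle)
open import Data.Bool.Base using (if_then_else_)
open import Data.Fin.Base using (Fin; zero; suc)
open import Data.Fin.Permutation using (_⟨$⟩ʳ_; _⟨$⟩ˡ_; inverseˡ; inverseʳ)
open import Data.Fin.Properties using (_≟_)
open import Data.List.Base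
  using ([]; _∷_; _++_; _∷ʳ′_; initLast; length; map; concatMap; reverse; foldr; allFin)
open import Data.List.Membership.Propositional using (_∈_)
open import Data.List.Membership.Propositional.Properties
  using (∈-allFin; ∈-concatMap⁺; ∈-filter⁺; ∈-filter⁻; ∈-map⁺)
open import Data.List.Membership.Propositional.Properties.WithK using (unique∧set⇒bag)
open import Data.List.Properties
  using (++-assoc; ++-identityʳ; concatMap-++; foldr-++; length-++; length-++-sucʳ; reverse-++)
open import Data.List.Relation.Binary.BagAndSetEquality using (∼bag⇒↭)
open import Data.List.Relation.Binary.Disjoint.Propositional using (Disjoint)
open import Data.List.Relation.Binary.Permutation.Propositional as ↭ using (_↭_)
open import Data.List.Relation.Binary.Permutation.Propositional.Properties
  using (All-resp-↭; ∈-resp-↭)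
import Data.List.Relation.Binary.Permutation.Setoid.Properties as ↭ₛ
open import Data.List.Relation.Binary.Pointwise using (Pointwise; []; _∷_)
open import Data.List.Relation.Unary.All as All using (All; []; _∷_)
import Data.List.Relation.Unary.All.Properties as All
open import Data.List.Relation.Unary.AllPairs as AllPairs using (AllPairs; []; _∷_)
import Data.List.Relation.Unary.AllPairs.Properties as AllPairs
open import Data.List.Relation.Unary.Any as Any using (here; there)
open import Data.List.Relation.Unary.Unique.Propositional using (Unique)
import Data.List.Relation.Unary.Unique.Propositional.Properties as Unique
import Data.Maybe.Base as Maybe
open import Data.Nat.Base as ℕ using (ℕ; zero; suc; parity)
open import Data.Nat.GeneralisedArithmetic using (fold)
import Data.Nat.Properties as ℕ
import Data.Parity.Base as ℙ
import Data.Parity.Properties as ℙ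
open import Data.Product.Base using (∃-syntax; _×_; _,_; proj₁; proj₂)
open import Data.Sum.Base using (_⊎_; inj₁; inj₂; swap)
import Data.Vec.Functional.Relation.Binary.Equality.Setoid
open import Function.Base using (_∘_; case_of_)
open import Function.Bundles using (_⇔_; mk⇔; module Equivalence)
open import Level using (0ℓ)
open import Relation.Binary.Bundles using (Setoid)
open import Relation.Binary.Construct.Add.Supremum.NonStrict ℕ._≤_ using (_≤⁺_; [_]; _≤⊤⁺)
import Relation.Binary.Reasoning.Setoid
open import Relation.Binary.PropositionalEquality as ≡ using (_≡_; _≢_; refl; cong; subst)
open import Relation.Binary.Structures using (IsTotalOrder)
open import Relation.Nullary.Construct.Add.Supremum using () renaming ([_] to fin; ⊤⁺ to ∞)
open import Relation.Nullary.Decidable.Core using (yes; no; does; dec⇒maybe)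
open import Relation.Nullary.Negation.Core using (¬_; contradiction)

-- The two root spaces cannot be compared by an isometry that sends simple roots to multiples of
-- orbit sums: if an orbit of two vertices is joined to an orbit of one vertex by bonds labelled ∞,
-- the normalised orbit sums pair to -√2, while `B` for `M′` gives -1. So only signs are compared.
-- They come twice from one induction, `positivity`, whose property is a parameter. Its dihedral
-- case is trigonometry inside a single group; in the folded case it rests on `order`, used in two
-- ways: the prescribed power of a product of two orbit products is trivial, which makes φ a
-- homomorphism, and no smaller power is, which rules out a premature negative root. The action on V
-- must be faithful, because the conjugation is found on simple roots but is needed as an equation
-- in W. Finally, L may be larger than φ(L′); since it is cut out by all half-spaces containing
-- φ(L′), membership of a root in R(L) can still be tested on φ(L′) alone, and this is what makes
-- the toggles agree.

-- Words alternating in two letters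

^-snoc : ∀ {n} (i j : Fin n) k → i ∷ (j ∷ i ∷ []) ^ k ++ j ∷ [] ≡ (i ∷ j ∷ []) ^ suc k
^-snoc i j zero    = refl
^-snoc i j (suc k) = cong (λ w → i ∷ j ∷ w) (^-snoc i j k)

pred-≤⁺ : ∀ {k ℓ} → fin (suc k) ≤⁺ ℓ → fin k ≤⁺ ℓ
pred-≤⁺ [ p ]   = [ ℕ.<⇒≤ p ]
pred-≤⁺ (_ ≤⊤⁺) = _ ≤⊤⁺

-- The alternating word in i and j of length k that ends in j.
alternating : ∀ {n} → Fin n → Fin n → ℕ → Word n
alternating i j zero    = []
alternating i j (suc k) = alternating j i k ++ j ∷ []

-- The letter that continues the alternation when put in front of `alternating i j k`. It is needed
-- because `alternating` recurses at its right end while words get extended at the left.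
nextLetter : ∀ {n} → Fin n → Fin n → ℕ → Fin n
nextLetter i j zero    = j
nextLetter i j (suc k) = nextLetter j i k

nextLetter-elim : ∀ {n} (P : Fin n → Set) {i j} → P i → P j → ∀ k → P (nextLetter i j k)
nextLetter-elim P p q zero    = q
nextLetter-elim P p q (suc k) = nextLetter-elim P q p k

nextLetter-complete : ∀ {n} {i j t : Fin n} k → t ≡ i ⊎ t ≡ j →
                      t ≡ nextLetter i j (suc k) ⊎ t ≡ nextLetter i j k
nextLetter-complete zero    t∈ = t∈
nextLetter-complete (suc k) t∈ = nextLetter-complete k (swap t∈)

alternating-cons : ∀ {n} (i j : Fin n) k →
                   alternating i j (suc k) ≡ nextLetter i j k ∷ alternating i j k
alternating-cons i j zero    = refl
alternating-cons i j (suc k) = cong (_++ j ∷ []) (alternating-cons j i k)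

length-alternating : ∀ {n} (i j : Fin n) k → length (alternating i j k) ≡ k
length-alternating i j zero    = refl
length-alternating i j (suc k) =
  ≡.trans (cong length (alternating-cons i j k)) (cong suc (length-alternating i j k))

alternating-suffix : ∀ {n} (i j : Fin n) a b →
  ∃[ w ] length w ≡ a × alternating i j (a ℕ.+ b) ≡ w ++ alternating i j b
alternating-suffix i j zero    b = [] , refl , refl
alternating-suffix i j (suc a) b with w , e , f ← alternating-suffix i j a b =
  nextLetter i j (a ℕ.+ b) ∷ w , cong suc e ,
  ≡.trans (alternating-cons i j (a ℕ.+ b)) (cong (nextLetter i j (a ℕ.+ b) ∷_) f)

-- Relators and orders speak of powers of a two-letter word; this identity turns a comparison of two
-- alternating words into such a power.
reverse-alternating-++ : ∀ {n} (i j : Fin n) k →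
  reverse (alternating i j k) ++ alternating j i k ≡ (j ∷ i ∷ []) ^ k
reverse-alternating-++ i j zero    = refl
reverse-alternating-++ i j (suc k) = begin
  reverse (alternating j i k ++ j ∷ []) ++ alternating i j k ++ i ∷ []
    ≡⟨ cong (_++ alternating i j k ++ i ∷ []) (reverse-++ (alternating j i k) (j ∷ [])) ⟩
  j ∷ reverse (alternating j i k) ++ alternating i j k ++ i ∷ []
    ≡⟨ cong (j ∷_) (++-assoc (reverse (alternating j i k)) (alternating i j k) (i ∷ [])) ⟨
  j ∷ (reverse (alternating j i k) ++ alternating i j k) ++ i ∷ []
    ≡⟨ cong (λ w → j ∷ w ++ i ∷ []) (reverse-alternating-++ j i k) ⟩
  j ∷ (i ∷ j ∷ []) ^ k ++ i ∷ []
    ≡⟨ ^-snoc j i k ⟩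
  (j ∷ i ∷ []) ^ suc k ∎
  where open ≡.≡-Reasoning

-- Reduced words and dihedral decompositions

module Words {n : ℕ} (M : CoxeterMatrix n) where
  open CoxeterMatrix M public
  module G = Group (coxeterGroup M)
  infix 4 _≋_
  _≋_ : Word n → Word n → Set
  _≋_ = WordEq M

  ≡⇒≋ : ∀ {u v} → u ≡ v → u ≋ v
  ≡⇒≋ = G.reflexive

  -- All relators have even length.
  parity-length : ∀ {u v} → u ≋ v → parity (length u) ≡ parity (length v)
  parity-length (relator i j {k} _) = even k
    where
    even : ∀ k → parity (length ((i ∷ j ∷ []) ^ k)) ≡ ℙ.0ℙ
    even zero    = refl
    even (suc k) = even k
  parity-length ≋-refl        = refl
  parity-length (≋-sym p)     = ≡.sym (parity-length p)
  parity-length (≋-trans p q) = ≡.trans (parity-length p) (parity-length q)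
  parity-length (++-cong {u} {u′} {v} {v′} p q) = begin
    parity (length (u ++ v))                ≡⟨ cong parity (length-++ u) ⟩
    parity (length u ℕ.+ length v)          ≡⟨ ℙ.+-homo-+ (length u) (length v) ⟩
    parity (length u) ℙ.+ parity (length v) ≡⟨ ≡.cong₂ ℙ._+_ (parity-length p) (parity-length q) ⟩
    parity (length u′) ℙ.+ parity (length v′) ≡⟨ ℙ.+-homo-+ (length u′) (length v′) ⟨
    parity (length u′ ℕ.+ length v′)        ≡⟨ cong parity (length-++ u′) ⟨
    parity (length (u′ ++ v′))              ∎
    where open ≡.≡-Reasoning

  open import Relation.Binary.Reasoning.Setoid G.setoid

  cancel : ∀ u i v → u ++ i ∷ i ∷ v ≋ u ++ v
  cancel u i v = G.∙-congˡ {u} (G.∙-congʳ {v} (relator i i (diagonal i)))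

  cancelʳ : ∀ u i → (u ++ i ∷ []) ++ i ∷ [] ≋ u
  cancelʳ u i = begin
    (u ++ i ∷ []) ++ i ∷ [] ≡⟨ ++-assoc u (i ∷ []) (i ∷ []) ⟩
    u ++ i ∷ i ∷ []         ≈⟨ cancel u i [] ⟩
    u ++ []                 ≡⟨ ++-identityʳ u ⟩
    u                       ∎

  -- The braid relation: inserting the relator `(j ∷ i ∷ []) ^ k`, which equals `reverse a ++ b`,
  -- after `a` turns `a` into `b`.
  alternating-relation : ∀ {i j k} → m i j ≡ fin k → alternating i j k ≋ alternating j i k
  alternating-relation {i} {j} {k} e = begin
    a                     ≡⟨ ++-identityʳ a ⟨
    a ++ []               ≈⟨ G.∙-congˡ {a} (relator j i (≡.trans (symmetric j i) e)) ⟨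
    a ++ (j ∷ i ∷ []) ^ k ≡⟨ cong (a ++_) (reverse-alternating-++ i j k) ⟨
    a ++ reverse a ++ b   ≡⟨ ++-assoc a (reverse a) b ⟨
    (a ++ reverse a) ++ b ≈⟨ G.∙-congʳ {b} (G.inverseʳ a) ⟩
    b                     ∎
    where
    a b : Word n
    a = alternating i j k
    b = alternating j i k

  Reduced : Word n → Set
  Reduced w = ∀ u → u ≋ w → length w ℕ.≤ length u

  Reduced-resp : ∀ {u v} → u ≋ v → length u ≡ length v → Reduced v → Reduced u
  Reduced-resp u≋v e r x x≋u = subst (ℕ._≤ length x) (≡.sym e) (r x (G.trans x≋u u≋v))

  Reduced-++ˡ : ∀ u v → Reduced (u ++ v) → Reduced u
  Reduced-++ˡ u v r x x≋u = ℕ.+-cancelʳ-≤ (length v) _ _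
    (≡.subst₂ ℕ._≤_ (length-++ u) (length-++ x) (r (x ++ v) (G.∙-congʳ {v} x≋u)))

  Reduced-++ʳ : ∀ u v → Reduced (u ++ v) → Reduced v
  Reduced-++ʳ u v r x x≋v = ℕ.+-cancelˡ-≤ (length u) _ _
    (≡.subst₂ ℕ._≤_ (length-++ u) (length-++ u) (r (u ++ x) (G.∙-congˡ {u} x≋v)))

  ¬Reduced-repeat : ∀ u i v → ¬ Reduced (u ++ i ∷ i ∷ v)
  ¬Reduced-repeat u i v r = ℕ.<⇒≱ {length v} (ℕ.m≤n⇒m≤1+n ℕ.≤-refl)
    (Reduced-++ʳ u (i ∷ i ∷ v) r v (G.sym (cancel [] i v)))

  -- In the suffix of length `suc (suc k)`, the braid relation makes the first `suc k` letters end
  -- in `j`, which cancels against the final `j`.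
  ¬Reduced-longAlternating : ∀ {i j k l} → m i j ≡ fin (suc k) → suc (suc k) ℕ.≤ l →
                             ¬ Reduced (alternating i j l)
  ¬Reduced-longAlternating {i} {j} {k} {l} e k<l r
    with c , refl ← ℕ.m≤n⇒∃[o]m+o≡n k<l
    with w , _ , f ← alternating-suffix i j c (suc (suc k)) = ℕ.<⇒≱ (ℕ.n<1+n k) (ℕ.≤-trans
      (ℕ.n≤1+n (suc k))
      (≡.subst₂ ℕ._≤_ (length-alternating i j (suc (suc k))) (length-alternating j i k)
        (Reduced-++ʳ w (alternating i j (suc (suc k)))
          (subst Reduced (≡.trans (cong (alternating i j) (ℕ.+-comm (suc (suc k)) c)) f) r)
          (alternating j i k) shorter)))
    where
    shorter : alternating j i k ≋ alternating i j (suc (suc k))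
    shorter = begin
      alternating j i k                             ≈⟨ cancelʳ (alternating j i k) j ⟨
      alternating i j (suc k) ++ j ∷ []             ≈⟨ G.∙-congʳ {j ∷ []} (alternating-relation e) ⟩
      alternating i j (suc (suc k))                 ∎

  module _ (em : ExcludedMiddle 0ℓ) where

    reducedWord : ∀ w → ∃[ u ] u ≋ w × Reduced u
    reducedWord w = go (length w) w ℕ.≤-refl
      where
      go : ∀ N w → length w ℕ.≤ N → ∃[ u ] u ≋ w × Reduced u
      go N w b with em {∃[ u ] u ≋ w × length u ℕ.< length w}
      ... | no ∄u = w , G.refl , λ u u≋w → ℕ.≮⇒≥ λ u<w → ∄u (u , u≋w , u<w)
      go zero    w b | yes (u , _ , u<w) with () ← ℕ.<-≤-trans u<w b
      go (suc N) w b | yes (u , u≋w , u<w)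
        with v , v≋u , r ← go N u (ℕ.s≤s⁻¹ (ℕ.≤-trans u<w b)) = v , G.trans v≋u u≋w , r

    -- A word for `w ++ i ∷ []` that is shorter than it cannot have the length of `w`, by parity;
    -- hence right multiplication by a generator changes the minimal length by exactly one.
    descent : ∀ {w i} → Reduced w → ¬ Reduced (w ++ i ∷ []) →
              ∃[ v ] v ++ i ∷ [] ≋ w × suc (length v) ≡ length w
    descent {w} {i} r ¬r with em {∃[ u ] u ≋ w ++ i ∷ [] × length u ℕ.< length (w ++ i ∷ [])}
    ... | no ∄u = contradiction (λ u e → ℕ.≮⇒≥ λ u<w → ∄u (u , e , u<w)) ¬r
    ... | yes (u , u≋ , u<) = u , ui≋w , ℕ.≤-antisym u<w (subst (length w ℕ.≤_) (length-snoc u) (r _ ui≋w))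
      where
      length-snoc : ∀ (u : Word n) → length (u ++ i ∷ []) ≡ suc (length u)
      length-snoc u = ≡.trans (length-++ u) (ℕ.+-comm (length u) 1)
      ui≋w : u ++ i ∷ [] ≋ w
      ui≋w = G.trans (G.∙-congʳ {i ∷ []} u≋) (cancelʳ w i)
      parity-suc : ∀ k → parity (suc k) ≢ parity k
      parity-suc zero    ()
      parity-suc (suc k) e = parity-suc k (≡.sym e)
      u<w : length u ℕ.< length w
      u<w = ℕ.≤∧≢⇒< (ℕ.s≤s⁻¹ (subst (length u ℕ.<_) (length-snoc w) u<)) λ e →
        parity-suc (length w) (≡.trans (cong parity (≡.sym (length-snoc w)))
          (≡.trans (≡.sym (parity-length u≋)) (cong parity e)))

    -- When w ++ [ i ] is reduced and w ends in j, w equals a shortest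
    -- representative v of its coset modulo ⟨ s_i , s_j ⟩ times an alternating word.
    record DihedralDecomposition (i j : Fin n) (w : Word n) : Set where
      field
        v        : Word n
        k        : ℕ
        equal    : v ++ alternating i j (suc k) ≋ w
        shorter  : length v ℕ.< length w
        reduced  : Reduced ((v ++ alternating i j (suc k)) ++ i ∷ [])
        reducedᵢ : Reduced (v ++ i ∷ [])
        reducedⱼ : Reduced (v ++ j ∷ [])

    -- If `v ++ t ∷ []` is not reduced, then `v` can be rewritten to end in `t`. Either `t`
    -- continues the alternating word, and it moves across from the shorter prefix, or `t` is
    -- already its first letter, and the cancellation contradicts reducedness. `N` bounds the length
    -- of `v` and makes the mutual recursion with `decompose` terminate.
    peel : ∀ N i j {w} v k → length v ℕ.≤ N → length v ℕ.< length w →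
      v ++ alternating i j (suc k) ≋ w → Reduced ((v ++ alternating i j (suc k)) ++ i ∷ []) →
      ∀ {t} → t ≡ i ⊎ t ≡ j → ¬ Reduced (v ++ t ∷ []) → DihedralDecomposition i j w

    decompose : ∀ N i j {w} v k → length v ℕ.≤ N → length v ℕ.< length w →
      v ++ alternating i j (suc k) ≋ w → Reduced ((v ++ alternating i j (suc k)) ++ i ∷ []) →
      DihedralDecomposition i j w
    decompose N i j {w} v k v≤N v<w eq r
      with em {Reduced (v ++ i ∷ [])} | em {Reduced (v ++ j ∷ [])}
    ... | yes rᵢ | yes rⱼ = record { v = v ; k = k ; equal = eq ; shorter = v<w ; reduced = r
                                   ; reducedᵢ = rᵢ ; reducedⱼ = rⱼ }
    ... | no ¬r  | _      = peel N i j v k v≤N v<w eq r (inj₁ refl) ¬r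
    ... | yes _  | no ¬r  = peel N i j v k v≤N v<w eq r (inj₂ refl) ¬r

    peel N i j {w} v k v≤N v<w eq r {t} t∈ ¬r = step N v≤N (nextLetter-complete k t∈)
      (descent (Reduced-++ˡ v a (Reduced-++ˡ (v ++ a) (i ∷ []) r)) ¬r)
      where
      a : Word n
      a = alternating i j (suc k)
      length-++-cong : ∀ (u v : Word n) → length u ≡ length v → ∀ w → length (u ++ w) ≡ length (v ++ w)
      length-++-cong u v e w =
        ≡.trans (length-++ u) (≡.trans (cong (ℕ._+ length w) e) (≡.sym (length-++ v)))
      step : ∀ N → length v ℕ.≤ N → t ≡ nextLetter j i k ⊎ t ≡ nextLetter i j k →
             ∃[ v′ ] v′ ++ t ∷ [] ≋ v × suc (length v′) ≡ length v → DihedralDecomposition i j w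
      step zero    v≤N _ (v′ , _ , v′<v) with () ← ℕ.≤-trans (ℕ.≤-reflexive v′<v) v≤N
      step (suc N) v≤N (inj₁ refl) (v′ , v′t≋v , v′<v) =
        decompose N i j v′ (suc k) (ℕ.s≤s⁻¹ (ℕ.≤-trans (ℕ.≤-reflexive v′<v) v≤N))
          (ℕ.<-trans (ℕ.≤-reflexive v′<v) v<w) (G.trans same eq)
          (Reduced-resp (G.∙-congʳ {i ∷ []} same) same-length r)
        where
        split : v′ ++ alternating i j (suc (suc k)) ≡ (v′ ++ t ∷ []) ++ a
        split = ≡.trans (cong (v′ ++_) (alternating-cons i j (suc k)))
                        (≡.sym (++-assoc v′ (t ∷ []) a))
        same : v′ ++ alternating i j (suc (suc k)) ≋ v ++ a
        same = G.trans (≡⇒≋ split) (G.∙-congʳ {a} v′t≋v)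
        same-length : length ((v′ ++ alternating i j (suc (suc k))) ++ i ∷ []) ≡ length ((v ++ a) ++ i ∷ [])
        same-length = ≡.trans (cong (λ u → length (u ++ i ∷ [])) split)
          (length-++-cong ((v′ ++ t ∷ []) ++ a) (v ++ a)
            (length-++-cong (v′ ++ t ∷ []) v (≡.trans (length-++-sucʳ v′ t [])
            (≡.trans (cong (suc ∘ length) (++-identityʳ v′)) v′<v)) a) (i ∷ []))
      step N v≤N (inj₂ refl) (v′ , v′t≋v , v′<v) = contradiction
        (Reduced-++ˡ (v ++ a) (i ∷ []) r (v′ ++ alternating i j k) (G.sym (begin
          v ++ a                            ≈⟨ G.∙-congʳ {a} v′t≋v ⟨
          (v′ ++ t ∷ []) ++ a               ≡⟨ ++-assoc v′ (t ∷ []) a ⟩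
          v′ ++ t ∷ a                       ≡⟨ cong (λ u → v′ ++ t ∷ u) (alternating-cons i j k) ⟩
          v′ ++ t ∷ t ∷ alternating i j k   ≈⟨ cancel v′ t (alternating i j k) ⟩
          v′ ++ alternating i j k           ∎)))
        (ℕ.<⇒≱ (≡.subst₂ ℕ._<_
          (≡.sym (≡.trans (length-++ v′) (cong (length v′ ℕ.+_) (length-alternating i j k))))
          (≡.sym (≡.trans (length-++ v) (cong (length v ℕ.+_) (length-alternating i j (suc k)))))
          (ℕ.+-mono-< (ℕ.≤-reflexive v′<v) (ℕ.n<1+n k))))

    -- Induction on the length of `w`, with `P` abstract so that it serves both for roots of one
    -- group and for folded roots. The prefix of a dihedral decomposition is shorter than `w` and
    -- stays reduced when followed by either generator, so the induction hypothesis covers both;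
    -- only the dihedral step depends on `P`.
    positivity : (P : Word n → Fin n → Set) →
      (∀ {u v i} → u ≋ v → P u i → P v i) →
      (∀ i → P [] i) →
      (∀ {i j} → i ≢ j → ∀ v k → P v i → P v j → fin (suc k) ≤⁺ m i j →
         P (v ++ alternating i j k) i) →
      ∀ w i → Reduced (w ++ i ∷ []) → P w i
    positivity P P-resp P-[] P-dihedral w i = go (suc (length w)) w i (ℕ.n<1+n (length w))
      where
      go : ∀ N w i → length w ℕ.< N → Reduced (w ++ i ∷ []) → P w i
      go (suc N) w i b r with initLast w
      ... | []      = P-[] i
      ... | w ∷ʳ′ j = P-resp D.equal (P-dihedral i≢j D.v (suc D.k)
              (go N D.v i v<N D.reducedᵢ) (go N D.v j v<N D.reducedⱼ) k<m)
        where
        D : DihedralDecomposition i j (w ++ j ∷ [])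
        D = decompose (length w) i j w 0 ℕ.≤-refl
              (ℕ.≤-reflexive (≡.sym (≡.trans (length-++ w) (ℕ.+-comm (length w) 1)))) G.refl r
        module D = DihedralDecomposition D
        v<N : length D.v ℕ.< N
        v<N = ℕ.<-≤-trans D.shorter (ℕ.s≤s⁻¹ b)
        i≢j : i ≢ j
        i≢j refl = ¬Reduced-repeat w i [] (subst Reduced (++-assoc w (i ∷ []) (i ∷ [])) r)
        -- The alternating suffix together with the final `i` is a reduced alternating word of
        -- length `D.k + 2`, and such words are no longer than the label.
        k<m : fin (suc (suc D.k)) ≤⁺ m i j
        k<m with m i j in e | offDiagonal i j i≢j
        ... | ∞           | _ = _ ≤⊤⁺
        ... | fin zero    | [ () ]
        ... | fin (suc l) | _ = [ ℕ.≮⇒≥ (λ l<k → ¬Reduced-longAlternating (≡.trans (symmetric j i) e)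
                               l<k (Reduced-++ʳ D.v _ (subst Reduced (++-assoc D.v _ (i ∷ [])) D.reduced))) ]

-- A ring solver over formal integers, whose equality is decidable

module IntegerCoefficientSolver {c ℓ} (R : CommutativeRing c ℓ) where
  open CommutativeRing R renaming (refl to ≈-refl)
  open Algebra.Properties.Semiring.Mult.TCOptimised semiring renaming (_×_ to _×′_)
  open Algebra.Properties.Ring ring using (-‿distribˡ-*; -‿distribʳ-*; -0#≈0#; -‿involutive)
  open Algebra.Properties.AbelianGroup +-abelianGroup using () renaming (⁻¹-∙-comm to -‿+-comm)
  open import Relation.Binary.Reasoning.Setoid setoid
  private
    open import Algebra.Solver.Ring.NaturalCoefficients.Default commutativeSemiring
      using () renaming (solve to solveℕ; _:+_ to _⊕_; _:*_ to _⊗_; _:=_ to _⊜_)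

    -- Canonical representatives are needed since the solver compares normal forms syntactically.
    normalise : ℕ × ℕ → ℕ × ℕ
    normalise (suc a , suc b) = normalise (a , b)
    normalise (a , b)         = a , b

    -- (a , b) stands for a - b.
    coefficients : RawRing 0ℓ 0ℓ
    coefficients = record
      { Carrier = ℕ × ℕ
      ; _≈_     = _≡_
      ; _+_     = λ (a , b) (c , d) → normalise (a ℕ.+ c , b ℕ.+ d)
      ; _*_     = λ (a , b) (c , d) → normalise (a ℕ.* c ℕ.+ b ℕ.* d , a ℕ.* d ℕ.+ b ℕ.* c)
      ; -_      = λ (a , b) → b , a
      ; 0#      = 0 , 0
      ; 1#      = 1 , 0
      }
    module C = RawRing coefficients

    ⟨_⟩ : ℕ → Carrier
    ⟨ a ⟩ = a ×′ 1#

    -- The second clause keeps the value of (a , 0) free of spurious subtractions.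
    eval : ℕ × ℕ → Carrier
    eval (a , zero)  = ⟨ a ⟩
    eval (a , suc b) = ⟨ a ⟩ - ⟨ suc b ⟩

    eval≈ : ∀ a b → eval (a , b) ≈ ⟨ a ⟩ - ⟨ b ⟩
    eval≈ a zero    = sym (trans (+-congˡ -0#≈0#) (+-identityʳ _))
    eval≈ a (suc b) = ≈-refl

    eval-cong : ∀ a b c d → a ℕ.+ d ≡ c ℕ.+ b → eval (a , b) ≈ eval (c , d)
    eval-cong a b c d e = begin
      eval (a , b)                              ≈⟨ eval≈ a b ⟩
      ⟨ a ⟩ - ⟨ b ⟩                             ≈⟨ +-congʳ (trans (+-congˡ (-‿inverseʳ ⟨ d ⟩)) (+-identityʳ _)) ⟨
      (⟨ a ⟩ + (⟨ d ⟩ - ⟨ d ⟩)) - ⟨ b ⟩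
        ≈⟨ solveℕ 4 (λ a d e b → (a ⊕ (d ⊕ e)) ⊕ b ⊜ (a ⊕ d) ⊕ (e ⊕ b)) ≈-refl _ _ _ _ ⟩
      (⟨ a ⟩ + ⟨ d ⟩) + (- ⟨ d ⟩ - ⟨ b ⟩)
        ≈⟨ +-congʳ (trans (sym (×-homo-+ 1# a d)) (trans (reflexive (≡.cong ⟨_⟩ e)) (×-homo-+ 1# c b))) ⟩
      (⟨ c ⟩ + ⟨ b ⟩) + (- ⟨ d ⟩ - ⟨ b ⟩)
        ≈⟨ solveℕ 4 (λ a d e b → (a ⊕ d) ⊕ (e ⊕ b) ⊜ (a ⊕ (d ⊕ b)) ⊕ e) ≈-refl _ _ _ _ ⟩
      (⟨ c ⟩ + (⟨ b ⟩ - ⟨ b ⟩)) - ⟨ d ⟩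
        ≈⟨ +-congʳ (trans (+-congˡ (-‿inverseʳ ⟨ b ⟩)) (+-identityʳ _)) ⟩
      ⟨ c ⟩ - ⟨ d ⟩                             ≈⟨ eval≈ c d ⟨
      eval (c , d)                              ∎

    eval-normalise : ∀ a b → eval (normalise (a , b)) ≈ eval (a , b)
    eval-normalise zero    b       = ≈-refl
    eval-normalise (suc a) zero    = ≈-refl
    eval-normalise (suc a) (suc b) = trans (eval-normalise a b) (eval-cong a b (suc a) (suc b) (ℕ.+-suc a b))

    +-homo : ∀ x y → eval (x C.+ y) ≈ eval x + eval y
    +-homo (a , b) (c , d) = begin
      eval ((a , b) C.+ (c , d))                  ≈⟨ eval-normalise (a ℕ.+ c) (b ℕ.+ d) ⟩
      eval (a ℕ.+ c , b ℕ.+ d)                    ≈⟨ eval≈ (a ℕ.+ c) (b ℕ.+ d) ⟩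
      ⟨ a ℕ.+ c ⟩ - ⟨ b ℕ.+ d ⟩                   ≈⟨ +-cong (×-homo-+ 1# a c) (-‿cong (×-homo-+ 1# b d)) ⟩
      ⟨ a ⟩ + ⟨ c ⟩ - (⟨ b ⟩ + ⟨ d ⟩)             ≈⟨ +-congˡ (-‿+-comm _ _) ⟨
      ⟨ a ⟩ + ⟨ c ⟩ + (- ⟨ b ⟩ + - ⟨ d ⟩)
        ≈⟨ solveℕ 4 (λ a b c d → (a ⊕ c) ⊕ (b ⊕ d) ⊜ (a ⊕ b) ⊕ (c ⊕ d)) ≈-refl _ _ _ _ ⟩
      (⟨ a ⟩ - ⟨ b ⟩) + (⟨ c ⟩ - ⟨ d ⟩)           ≈⟨ +-cong (eval≈ a b) (eval≈ c d) ⟨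
      eval (a , b) + eval (c , d)                 ∎

    *-homo : ∀ x y → eval (x C.* y) ≈ eval x * eval y
    *-homo (a , b) (c , d) = begin
      eval ((a , b) C.* (c , d))                  ≈⟨ eval-normalise p q ⟩
      eval (p , q)                                ≈⟨ eval≈ p q ⟩
      ⟨ p ⟩ - ⟨ q ⟩
        ≈⟨ +-cong (dist a c b d) (trans (-‿cong (dist a d b c)) (sym (-‿+-comm _ _))) ⟩
      ⟨ a ⟩ * ⟨ c ⟩ + ⟨ b ⟩ * ⟨ d ⟩ + (- (⟨ a ⟩ * ⟨ d ⟩) + - (⟨ b ⟩ * ⟨ c ⟩))
        ≈⟨ +-cong (+-congˡ (trans (sym (-‿involutive _)) (trans (-‿cong (-‿distribˡ-* _ _)) (-‿distribʳ-* _ _))))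
                  (+-cong (-‿distribʳ-* _ _) (-‿distribˡ-* _ _)) ⟩
      ⟨ a ⟩ * ⟨ c ⟩ + - ⟨ b ⟩ * - ⟨ d ⟩ + (⟨ a ⟩ * - ⟨ d ⟩ + - ⟨ b ⟩ * ⟨ c ⟩)
        ≈⟨ solveℕ 4 (λ a b c d → ((a ⊗ c) ⊕ (b ⊗ d)) ⊕ ((a ⊗ d) ⊕ (b ⊗ c)) ⊜ (a ⊕ b) ⊗ (c ⊕ d)) ≈-refl _ _ _ _ ⟩
      (⟨ a ⟩ - ⟨ b ⟩) * (⟨ c ⟩ - ⟨ d ⟩)           ≈⟨ *-cong (eval≈ a b) (eval≈ c d) ⟨
      eval (a , b) * eval (c , d)                 ∎
      where
      p q : ℕ
      p = a ℕ.* c ℕ.+ b ℕ.* d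
      q = a ℕ.* d ℕ.+ b ℕ.* c
      dist : ∀ a c b d → ⟨ a ℕ.* c ℕ.+ b ℕ.* d ⟩ ≈ ⟨ a ⟩ * ⟨ c ⟩ + ⟨ b ⟩ * ⟨ d ⟩
      dist a c b d = trans (×-homo-+ 1# (a ℕ.* c) (b ℕ.* d)) (+-cong (×1-homo-* a c) (×1-homo-* b d))

    -‿homo : ∀ x → eval (C.- x) ≈ - eval x
    -‿homo (a , b) = begin
      eval (b , a)          ≈⟨ eval≈ b a ⟩
      ⟨ b ⟩ - ⟨ a ⟩         ≈⟨ +-comm _ _ ⟩
      - ⟨ a ⟩ + ⟨ b ⟩       ≈⟨ +-congˡ (-‿involutive _) ⟨
      - ⟨ a ⟩ + - - ⟨ b ⟩   ≈⟨ -‿+-comm _ _ ⟩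
      - (⟨ a ⟩ - ⟨ b ⟩)     ≈⟨ -‿cong (eval≈ a b) ⟨
      - eval (a , b)        ∎

    morphism : coefficients -Raw-AlmostCommutative⟶ fromCommutativeRing R
    morphism = record { ⟦_⟧ = eval ; +-homo = +-homo ; *-homo = *-homo ; -‿homo = -‿homo
                      ; 0-homo = ≈-refl ; 1-homo = ≈-refl }

    _coeff≟_ : ∀ x y → Maybe.Maybe (eval x ≈ eval y)
    (a , b) coeff≟ (c , d) = Maybe.map (eval-cong a b c d) (dec⇒maybe (a ℕ.+ d ℕ.≟ c ℕ.+ b))

  open Algebra.Solver.Ring coefficients (fromCommutativeRing R) morphism _coeff≟_ public
    using (Polynomial; solve; con; _:+_; _:*_; _:-_; :-_; _:=_)

  :0 :1 : ∀ {n} → Polynomial n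
  :0 = con (0 , 0)
  :1 = con (1 , 0)

-- Order, trigonometry and dihedral sequences over the reals

module RealField (em : ExcludedMiddle 0ℓ) (R : Reals) where
  open Reals R public
  open CommutativeRing commutativeRing public
    using ( +-cong; +-congˡ; +-congʳ; +-comm; +-identityˡ; +-identityʳ
          ; *-cong; *-congˡ; *-congʳ; *-assoc; *-comm; *-identityˡ; *-identityʳ
          ; -‿cong; -‿inverseʳ; zeroˡ; zeroʳ; distribʳ; semiring)
    renaming (refl to ≈-refl; sym to ≈-sym; trans to ≈-trans; reflexive to ≈-reflexive)
  open IntegerCoefficientSolver commutativeRing public
  open Algebra.Properties.Semiring.Mult semiring public
    using (×-homo-+) renaming (_×_ to _×ℝ_)
  open import Relation.Binary.Reasoning.Setoid setoid
  open IsTotalOrder isTotalOrder using (total; antisym; ≤-respʳ-≈; ≤-respˡ-≈)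
    renaming (refl to ≤-refl; reflexive to ≤-reflexive; trans to ≤-trans)

  2# : ℝ
  2# = 1# + 1#

  NonNeg : ℝ → Set
  NonNeg x = 0# ≤ x

  NonNeg-resp : ∀ {x y} → x ≈ y → NonNeg x → NonNeg y
  NonNeg-resp = ≤-respʳ-≈

  ≤⇒NonNeg : ∀ {x y} → x ≤ y → NonNeg (y - x)
  ≤⇒NonNeg {x} {y} p = ≤-respˡ-≈ (-‿inverseʳ x) (+-monoˡ-≤ (- x) p)

  NonNeg⇒≤ : ∀ {x y} → NonNeg (y - x) → x ≤ y
  NonNeg⇒≤ {x} {y} p = ≤-respˡ-≈ (+-identityˡ x) (≤-respʳ-≈
    (solve 2 (λ x y → (y :- x) :+ x := y) ≈-refl x y) (+-monoˡ-≤ x p))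

  NonNeg-0 : NonNeg 0#
  NonNeg-0 = ≤-refl

  NonNeg-+ : ∀ {x y} → NonNeg x → NonNeg y → NonNeg (x + y)
  NonNeg-+ {x} {y} p q = ≤-trans q (≤-respˡ-≈ (+-identityˡ y) (+-monoˡ-≤ y p))

  NonNeg-total : ∀ x → NonNeg x ⊎ NonNeg (- x)
  NonNeg-total x with total 0# x
  ... | inj₁ p = inj₁ p
  ... | inj₂ p = inj₂ (NonNeg-resp (+-identityˡ (- x)) (≤⇒NonNeg p))

  NonNeg-antisym : ∀ {x} → NonNeg x → NonNeg (- x) → x ≈ 0#
  NonNeg-antisym {x} p q = antisym (NonNeg⇒≤ (NonNeg-resp (≈-sym (+-identityˡ (- x))) q)) p

  NonNeg-square : ∀ x → NonNeg (x * x)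
  NonNeg-square x with NonNeg-total x
  ... | inj₁ p = *-nonNeg p p
  ... | inj₂ p = NonNeg-resp (solve 1 (λ x → :- x :* :- x := x :* x) ≈-refl x) (*-nonNeg p p)

  NonNeg-1 : NonNeg 1#
  NonNeg-1 = NonNeg-resp (*-identityˡ 1#) (NonNeg-square 1#)

  ¬NonNeg-‿1 : ¬ NonNeg (- 1#)
  ¬NonNeg-‿1 p = 0≉1 (≈-sym (NonNeg-antisym NonNeg-1 p))

  NonNeg-× : ∀ k → NonNeg (k ×ℝ 1#)
  NonNeg-× zero    = NonNeg-0
  NonNeg-× (suc k) = NonNeg-+ NonNeg-1 (NonNeg-× k)

  suc×1≉0 : ∀ k → ¬ (suc k ×ℝ 1# ≈ 0#)
  suc×1≉0 k e = ¬NonNeg-‿1 (NonNeg-resp (begin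
    k ×ℝ 1#                ≈⟨ solve 1 (λ x → x := (:1 :+ x) :- :1) ≈-refl (k ×ℝ 1#) ⟩
    suc k ×ℝ 1# - 1#       ≈⟨ +-congʳ e ⟩
    0# - 1#                ≈⟨ +-identityˡ _ ⟩
    - 1#                   ∎) (NonNeg-× k))

  *-cancelˡ-0 : ∀ {x y} → ¬ x ≈ 0# → x * y ≈ 0# → y ≈ 0#
  *-cancelˡ-0 {x} {y} x≉0 e = begin
    y               ≈⟨ *-identityˡ y ⟨
    1# * y          ≈⟨ *-congʳ (*-inverseʳ x x≉0) ⟨
    x * x ⁻¹ * y    ≈⟨ solve 3 (λ x y z → x :* y :* z := y :* (x :* z)) ≈-refl x (x ⁻¹) y ⟩
    x ⁻¹ * (x * y)  ≈⟨ *-congˡ e ⟩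
    x ⁻¹ * 0#       ≈⟨ zeroʳ _ ⟩
    0#              ∎

  square-0 : ∀ {x} → x * x ≈ 0# → x ≈ 0#
  square-0 {x} e with em {x ≈ 0#}
  ... | yes x≈0 = x≈0
  ... | no  x≉0 = *-cancelˡ-0 x≉0 e

  NonNeg-cancelˡ : ∀ {x y} → NonNeg x → ¬ x ≈ 0# → NonNeg (x * y) → NonNeg y
  NonNeg-cancelˡ {x} {y} p x≉0 q with NonNeg-total y
  ... | inj₁ r = r
  ... | inj₂ r = ≤-reflexive (≈-sym (*-cancelˡ-0 x≉0 (NonNeg-antisym q
          (NonNeg-resp (solve 2 (λ x y → x :* :- y := :- (x :* y)) ≈-refl x y) (*-nonNeg p r)))))

  0<⇒≉0 : ∀ {x} → 0# < x → ¬ x ≈ 0#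
  0<⇒≉0 (_ , ne) e = ne (≈-sym e)

  +-difference-0 : ∀ {x y} → x - y ≈ 0# → x ≈ y
  +-difference-0 {x} {y} e = begin
    x            ≈⟨ solve 2 (λ x y → x := (x :- y) :+ y) ≈-refl x y ⟩
    (x - y) + y  ≈⟨ +-congʳ e ⟩
    0# + y       ≈⟨ +-identityˡ y ⟩
    y            ∎

  halfπ : ℝ
  halfπ = π /ℕ 2

  halfπ+halfπ : halfπ + halfπ ≈ π
  halfπ+halfπ = begin
    halfπ + halfπ
      ≈⟨ solve 2 (λ p i → p :* i :+ p :* i := p :* ((:1 :+ (:1 :+ :0)) :* i)) ≈-refl π ((2 ×ℝ 1#) ⁻¹) ⟩
    π * (2 ×ℝ 1# * (2 ×ℝ 1#) ⁻¹) ≈⟨ *-congˡ (*-inverseʳ _ (suc×1≉0 1)) ⟩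
    π * 1#                     ≈⟨ *-identityʳ π ⟩
    π                          ∎

  cos²+sin² : ∀ x → cos x * cos x + sin x * sin x ≈ 1#
  cos²+sin² x = begin
    cos x * cos x + sin x * sin x ≈⟨ cos[y-x] x x ⟨
    cos (x - x)                   ≈⟨ cos-cong (-‿inverseʳ x) ⟩
    cos 0#                        ≈⟨ cos[0] ⟩
    1#                            ∎

  private
    +-cancel-1 : ∀ {x y} → x + y ≈ 1# → y ≈ 1# → x ≈ 0#
    +-cancel-1 {x} {y} e f = begin
      x          ≈⟨ solve 2 (λ x y → x := (x :+ y) :- y) ≈-refl x y ⟩
      x + y - y  ≈⟨ +-cong e (-‿cong f) ⟩
      1# - 1#    ≈⟨ -‿inverseʳ 1# ⟩
      0#         ∎

  cos[π/2] : cos halfπ ≈ 0#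
  cos[π/2] = square-0 (+-cancel-1 (cos²+sin² halfπ) (≈-trans (*-cong sin[π/2] sin[π/2]) (*-identityˡ 1#)))

  sin[0] : sin 0# ≈ 0#
  sin[0] = square-0 (+-cancel-1 (≈-trans (+-comm _ _) (cos²+sin² 0#)) (≈-trans (*-cong cos[0] cos[0]) (*-identityˡ 1#)))

  sin[π] : sin π ≈ 0#
  sin[π] = square-0 (+-cancel-1 (≈-trans (+-comm _ _) (cos²+sin² π))
    (≈-trans (*-cong cos[π] cos[π]) (solve 0 (:- :1 :* :- :1 := :1) ≈-refl)))

  cos-neg : ∀ x → cos (- x) ≈ cos x
  cos-neg x = begin
    cos (- x)                       ≈⟨ cos-cong (+-identityˡ (- x)) ⟨
    cos (0# - x)                    ≈⟨ cos[y-x] x 0# ⟩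
    cos 0# * cos x + sin 0# * sin x ≈⟨ +-cong (*-congʳ cos[0]) (*-congʳ sin[0]) ⟩
    1# * cos x + 0# * sin x         ≈⟨ solve 2 (λ c s → :1 :* c :+ :0 :* s := c) ≈-refl (cos x) (sin x) ⟩
    cos x                           ∎

  -- The only addition axiom is `cos[y-x]`; this case exchanges sine and cosine, and the remaining
  -- addition and shift formulas follow from it.
  cos[π/2-x] : ∀ x → cos (halfπ - x) ≈ sin x
  cos[π/2-x] x = begin
    cos (halfπ - x)                       ≈⟨ cos[y-x] x halfπ ⟩
    cos halfπ * cos x + sin halfπ * sin x ≈⟨ +-cong (*-congʳ cos[π/2]) (*-congʳ sin[π/2]) ⟩
    0# * cos x + 1# * sin x
      ≈⟨ solve 2 (λ c s → :0 :* c :+ :1 :* s := s) ≈-refl (cos x) (sin x) ⟩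
    sin x                                 ∎

  sin[π/2-x] : ∀ x → sin (halfπ - x) ≈ cos x
  sin[π/2-x] x = ≈-trans (≈-sym (cos[π/2-x] (halfπ - x)))
    (cos-cong (solve 2 (λ h x → h :- (h :- x) := x) ≈-refl halfπ x))

  cos[x+π/2] : ∀ x → cos (x + halfπ) ≈ - sin x
  cos[x+π/2] x = begin
    cos (x + halfπ)
      ≈⟨ cos-cong (solve 2 (λ h x → x :+ h := (h :+ h) :- (h :- x)) ≈-refl halfπ x) ⟩
    cos (halfπ + halfπ - (halfπ - x)) ≈⟨ cos-cong (+-congʳ halfπ+halfπ) ⟩
    cos (π - (halfπ - x))       ≈⟨ cos[y-x] (halfπ - x) π ⟩
    cos π * cos (halfπ - x) + sin π * sin (halfπ - x)
      ≈⟨ +-cong (*-cong cos[π] (cos[π/2-x] x)) (*-congʳ sin[π]) ⟩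
    - 1# * sin x + 0# * sin (halfπ - x)
      ≈⟨ solve 2 (λ s t → :- :1 :* s :+ :0 :* t := :- s) ≈-refl (sin x) _ ⟩
    - sin x                     ∎

  sin-neg : ∀ x → sin (- x) ≈ - sin x
  sin-neg x = begin
    sin (- x)           ≈⟨ cos[π/2-x] (- x) ⟨
    cos (halfπ - - x)   ≈⟨ cos-cong (solve 2 (λ h x → h :- :- x := x :+ h) ≈-refl halfπ x) ⟩
    cos (x + halfπ)     ≈⟨ cos[x+π/2] x ⟩
    - sin x             ∎

  sin[x+y] : ∀ x y → sin (x + y) ≈ sin x * cos y + cos x * sin y
  sin[x+y] x y = begin
    sin (x + y)             ≈⟨ cos[π/2-x] (x + y) ⟨
    cos (halfπ - (x + y))
      ≈⟨ cos-cong (solve 3 (λ h x y → h :- (x :+ y) := (h :- x) :- y) ≈-refl halfπ x y) ⟩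
    cos (halfπ - x - y)     ≈⟨ cos[y-x] y (halfπ - x) ⟩
    cos (halfπ - x) * cos y + sin (halfπ - x) * sin y
      ≈⟨ +-cong (*-congʳ (cos[π/2-x] x)) (*-congʳ (sin[π/2-x] x)) ⟩
    sin x * cos y + cos x * sin y ∎

  sin[π-x] : ∀ x → sin (π - x) ≈ sin x
  sin[π-x] x = begin
    sin (π - x)                     ≈⟨ sin[x+y] π (- x) ⟩
    sin π * cos (- x) + cos π * sin (- x) ≈⟨ +-cong (*-congʳ sin[π]) (*-cong cos[π] (sin-neg x)) ⟩
    0# * cos (- x) + - 1# * - sin x ≈⟨ solve 2 (λ c s → :0 :* c :+ :- :1 :* :- s := s) ≈-refl _ _ ⟩
    sin x                           ∎

  sin[x+π] : ∀ x → sin (x + π) ≈ - sin x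
  sin[x+π] x = begin
    sin (x + π)       ≈⟨ sin-cong (solve 2 (λ x p → x :+ p := p :- :- x) ≈-refl x π) ⟩
    sin (π - - x)     ≈⟨ sin[π-x] (- x) ⟩
    sin (- x)         ≈⟨ sin-neg x ⟩
    - sin x           ∎

  -- With `y = x + θ`, the terms in `cos y` cancel in sin (y + θ) + sin (y - θ).
  sin-recurrence : ∀ x θ → sin (x + θ + θ) ≈ 2# * cos θ * sin (x + θ) - sin x
  sin-recurrence x θ = begin
    sin (y + θ)         ≈⟨ solve 2 (λ a b → a := (a :+ b) :- b) ≈-refl _ (sin (y - θ)) ⟩
    sin (y + θ) + sin (y - θ) - sin (y - θ)
      ≈⟨ +-cong (+-cong (sin[x+y] y θ) (≈-trans (sin[x+y] y (- θ)) (+-cong (*-congˡ (cos-neg θ)) (*-congˡ (sin-neg θ)))))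
                (-‿cong (sin-cong (solve 2 (λ x t → (x :+ t) :- t := x) ≈-refl x θ))) ⟩
    sin y * cos θ + cos y * sin θ + (sin y * cos θ + cos y * - sin θ) - sin x
      ≈⟨ solve 5 (λ sy ct cy st sx → sy :* ct :+ cy :* st :+ (sy :* ct :+ cy :* :- st) :- sx
                  := (:1 :+ :1) :* ct :* sy :- sx) ≈-refl (sin y) (cos θ) (cos y) (sin θ) (sin x) ⟩
    2# * cos θ * sin y - sin x ∎
    where
    y : ℝ
    y = x + θ

  -- Below π/2 the axiom `x*cos<sin` applies; the endpoint lies outside its range and is supplied by
  -- `sin[π/2]`.
  sin-positive : ∀ {x} → 0# < x → x ≤ halfπ → 0# < sin x
  sin-positive {x} 0<x x≤h with em {x ≈ halfπ}
  ... | yes e = ≤-respʳ-≈ (≈-sym (≈-trans (sin-cong e) sin[π/2])) NonNeg-1 ,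
                λ f → 0≉1 (≈-trans f (≈-trans (sin-cong e) sin[π/2]))
  ... | no ne = ≤-trans nn (proj₁ lt) ,
                λ e → proj₂ lt (antisym (proj₁ lt) (≤-respˡ-≈ e nn))
    where
    lt : x * cos x < sin x
    lt = x*cos<sin x 0<x (x≤h , ne)
    nn : NonNeg (x * cos x)
    nn = *-nonNeg (proj₁ 0<x) (proj₁ (0<cos x 0<x (x≤h , ne)))

  sin-nonNeg-firstQuadrant : ∀ {x} → NonNeg x → x ≤ halfπ → NonNeg (sin x)
  sin-nonNeg-firstQuadrant {x} p x≤h with em {0# ≈ x}
  ... | yes e = ≤-reflexive (≈-trans (≈-sym sin[0]) (sin-cong e))
  ... | no ne = proj₁ (sin-positive (p , ne) x≤h)

  sin-nonNeg : ∀ {x} → NonNeg x → x ≤ π → NonNeg (sin x)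
  sin-nonNeg {x} p q with total x halfπ
  ... | inj₁ x≤h = sin-nonNeg-firstQuadrant p x≤h
  ... | inj₂ h≤x = NonNeg-resp (sin[π-x] x) (sin-nonNeg-firstQuadrant (≤⇒NonNeg q) (NonNeg⇒≤ (NonNeg-resp
          (≈-trans (solve 2 (λ h x → x :- h := h :- ((h :+ h) :- x)) ≈-refl halfπ x)
                   (+-congˡ (-‿cong (+-congʳ halfπ+halfπ)))) (≤⇒NonNeg h≤x))))

  form : ℕ∞ → ℝ
  form (fin k) = - cos (π /ℕ k)
  form ∞       = - 1#

  -- The coordinates of f 1 · (s_i s_j s_i ⋯ α_i) in the basis α_i , α_j:
  -- sin (kπ/m) for m finite, and k for m infinite.
  record DihedralSequence (ℓ : ℕ∞) : Set where
    field
      f          : ℕ → ℝ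
      f[0]       : f 0 ≈ 0#
      0<f[1]     : 0# < f 1
      recurrence : ∀ k → f (suc (suc k)) ≈ - f k - 2# * form ℓ * f (suc k)
      nonNeg     : ∀ {k} → fin k ≤⁺ ℓ → NonNeg (f k)

  -- For a finite label, the period 2ℓ makes the ℓ-th power of s_i s_j fix the plane of `α i` and
  -- `α j`, and `f[1]²` identifies the Gram determinant of that plane as a nonzero square.
  record DihedralPeriod (ℓ : ℕ) (s : DihedralSequence (fin ℓ)) : Set where
    open DihedralSequence s
    field
      period    : ∀ k → f (ℓ ℕ.* 2 ℕ.+ k) ≈ f k
      f[1]²     : f 1 * f 1 ≈ 1# - form (fin ℓ) * form (fin ℓ)

  sequence-∞ : DihedralSequence ∞
  sequence-∞ = record
    { f          = _×ℝ 1#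
    ; f[0]       = ≈-refl
    ; 0<f[1]     = NonNeg-× 1 , λ e → suc×1≉0 0 (≈-sym e)
    ; recurrence = λ k → solve 1 (λ x → :1 :+ (:1 :+ x)
        := :- x :- (:1 :+ :1) :* :- :1 :* (:1 :+ x)) ≈-refl (k ×ℝ 1#)
    ; nonNeg     = λ {k} _ → NonNeg-× k
    }

  module _ (d : ℕ) where
    private
      ℓ : ℕ
      ℓ = suc (suc d)
      θ : ℝ
      θ = π /ℕ ℓ

    sin[1×θ] : sin (1 ×ℝ 1# * θ) ≈ sin θ
    sin[1×θ] = sin-cong (solve 1 (λ t → (:1 :+ :0) :* t := t) ≈-refl θ)

    ℓ×θ : ℓ ×ℝ 1# * θ ≈ π
    ℓ×θ = begin
      ℓ ×ℝ 1# * θ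
        ≈⟨ solve 3 (λ l p i → l :* (p :* i) := p :* (l :* i)) ≈-refl (ℓ ×ℝ 1#) π _ ⟩
      π * (ℓ ×ℝ 1# * (ℓ ×ℝ 1#) ⁻¹)  ≈⟨ *-congˡ (*-inverseʳ _ (suc×1≉0 (suc d))) ⟩
      π * 1#                        ≈⟨ *-identityʳ π ⟩
      π                             ∎

    0≤θ : NonNeg θ
    0≤θ = NonNeg-cancelˡ (NonNeg-× ℓ) (suc×1≉0 (suc d)) (NonNeg-resp (≈-sym ℓ×θ) (proj₁ 0<π))

    0<θ : 0# < θ
    0<θ = 0≤θ , λ e → proj₂ 0<π (≈-sym (≈-trans (≈-sym ℓ×θ) (≈-trans (*-congˡ (≈-sym e)) (zeroʳ _))))

    θ≤π/2 : θ ≤ halfπ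
    θ≤π/2 = NonNeg⇒≤ (NonNeg-cancelˡ (NonNeg-× 2) (suc×1≉0 1)
      (NonNeg-resp (≈-sym (begin
        2 ×ℝ 1# * (halfπ - θ)
          ≈⟨ solve 2 (λ h t → (:1 :+ (:1 :+ :0)) :* (h :- t) := (h :+ h) :- (t :+ t)) ≈-refl halfπ θ ⟩
        halfπ + halfπ - (θ + θ)         ≈⟨ +-congʳ (≈-trans halfπ+halfπ (≈-sym ℓ×θ)) ⟩
        ℓ ×ℝ 1# * θ - (θ + θ)
          ≈⟨ solve 2 (λ d t → (:1 :+ (:1 :+ d)) :* t :- (t :+ t) := d :* t) ≈-refl (d ×ℝ 1#) θ ⟩
        d ×ℝ 1# * θ                     ∎)) (*-nonNeg (NonNeg-× d) 0≤θ)))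

    sequence-fin : DihedralSequence (fin ℓ)
    sequence-fin = record
      { f          = λ k → sin (k ×ℝ 1# * θ)
      ; f[0]       = ≈-trans (sin-cong (zeroˡ θ)) sin[0]
      ; 0<f[1]     = ≤-respʳ-≈ (≈-sym sin[1×θ]) (proj₁ 0<sinθ) , λ e → proj₂ 0<sinθ (≈-trans e sin[1×θ])
      ; recurrence = λ k → begin
          sin ((1# + (1# + k ×ℝ 1#)) * θ)
            ≈⟨ sin-cong (solve 2 (λ k t → (:1 :+ (:1 :+ k)) :* t := (k :* t :+ t) :+ t) ≈-refl (k ×ℝ 1#) θ) ⟩
          sin (k ×ℝ 1# * θ + θ + θ)       ≈⟨ sin-recurrence (k ×ℝ 1# * θ) θ ⟩
          2# * cos θ * sin (k ×ℝ 1# * θ + θ) - sin (k ×ℝ 1# * θ)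
            ≈⟨ +-congʳ (*-congˡ (sin-cong (solve 2 (λ k t → k :* t :+ t := (:1 :+ k) :* t) ≈-refl (k ×ℝ 1#) θ))) ⟩
          2# * cos θ * sin (suc k ×ℝ 1# * θ) - sin (k ×ℝ 1# * θ)
            ≈⟨ solve 3 (λ c s t → (:1 :+ :1) :* c :* s :- t := :- t :- (:1 :+ :1) :* (:- c) :* s) ≈-refl _ _ _ ⟩
          - sin (k ×ℝ 1# * θ) - 2# * - cos θ * sin (suc k ×ℝ 1# * θ) ∎
      ; nonNeg     = λ { {k} [ k≤ℓ ] → nonNeg k k≤ℓ }
      }
      where
      0<sinθ : 0# < sin θ
      0<sinθ = sin-positive 0<θ θ≤π/2
      nonNeg : ∀ k → k ℕ.≤ ℓ → NonNeg (sin (k ×ℝ 1# * θ))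
      nonNeg k k≤ℓ with c , e ← ℕ.m≤n⇒∃[o]m+o≡n k≤ℓ = sin-nonNeg (*-nonNeg (NonNeg-× k) 0≤θ)
        (NonNeg⇒≤ (NonNeg-resp (≈-sym (begin
          π - k ×ℝ 1# * θ                     ≈⟨ +-congʳ ℓ×θ ⟨
          ℓ ×ℝ 1# * θ - k ×ℝ 1# * θ           ≡⟨ cong (λ l → l ×ℝ 1# * θ - k ×ℝ 1# * θ) e ⟨
          (k ℕ.+ c) ×ℝ 1# * θ - k ×ℝ 1# * θ   ≈⟨ +-congʳ (*-congʳ (×-homo-+ 1# k c)) ⟩
          (k ×ℝ 1# + c ×ℝ 1#) * θ - k ×ℝ 1# * θ
            ≈⟨ solve 3 (λ k c t → (k :+ c) :* t :- k :* t := c :* t) ≈-refl _ _ _ ⟩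
          c ×ℝ 1# * θ ∎)) (*-nonNeg (NonNeg-× c) 0≤θ)))

    period-fin : DihedralPeriod ℓ sequence-fin
    period-fin = record
      { period = λ k → begin
          sin ((ℓ ℕ.* 2 ℕ.+ k) ×ℝ 1# * θ)
            ≈⟨ sin-cong (*-congʳ (≈-trans (×-homo-+ 1# (ℓ ℕ.* 2) k) (+-congʳ (≈-trans
                 (≈-reflexive (cong (_×ℝ 1#) (≡.trans (ℕ.*-comm ℓ 2) (cong (ℓ ℕ.+_) (ℕ.+-identityʳ ℓ))))) (×-homo-+ 1# ℓ ℓ))))) ⟩
          sin ((ℓ ×ℝ 1# + ℓ ×ℝ 1# + k ×ℝ 1#) * θ)
            ≈⟨ sin-cong (solve 3 (λ l k t → (l :+ l :+ k) :* t := (k :* t :+ l :* t) :+ l :* t) ≈-refl _ _ _) ⟩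
          sin (k ×ℝ 1# * θ + ℓ ×ℝ 1# * θ + ℓ ×ℝ 1# * θ) ≈⟨ sin-cong (+-cong (+-congˡ ℓ×θ) ℓ×θ) ⟩
          sin (k ×ℝ 1# * θ + π + π)   ≈⟨ sin[x+π] _ ⟩
          - sin (k ×ℝ 1# * θ + π)     ≈⟨ -‿cong (sin[x+π] _) ⟩
          - - sin (k ×ℝ 1# * θ)       ≈⟨ solve 1 (λ x → :- :- x := x) ≈-refl _ ⟩
          sin (k ×ℝ 1# * θ)           ∎
      ; f[1]² = begin
          sin (1 ×ℝ 1# * θ) * sin (1 ×ℝ 1# * θ) ≈⟨ *-cong sin[1×θ] sin[1×θ] ⟩
          sin θ * sin θ
            ≈⟨ solve 2 (λ s c → s :* s := (c :* c :+ s :* s) :- :- c :* :- c) ≈-refl (sin θ) (cos θ) ⟩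
          cos θ * cos θ + sin θ * sin θ - - cos θ * - cos θ ≈⟨ +-congʳ (cos²+sin² θ) ⟩
          1# - - cos θ * - cos θ ∎
      }

  dihedralSequence : ∀ {ℓ} → fin 2 ≤⁺ ℓ → DihedralSequence ℓ
  dihedralSequence {fin (suc (suc d))} [ _ ] = sequence-fin d
  dihedralSequence {∞}                 _     = sequence-∞
  dihedralSequence {fin zero}          [ () ]
  dihedralSequence {fin 1}             [ ℕ.s≤s () ]

  form-1 : form (fin 1) ≈ 1#
  form-1 = ≈-trans (-‿cong (≈-trans (cos-cong (begin
      π * (1# + 0#) ⁻¹                 ≈⟨ solve 2 (λ p i → p :* i := p :* ((:1 :+ :0) :* i)) ≈-refl π _ ⟩
      π * ((1# + 0#) * (1# + 0#) ⁻¹)   ≈⟨ *-congˡ (*-inverseʳ _ (suc×1≉0 0)) ⟩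
      π * 1#                           ≈⟨ *-identityʳ π ⟩
      π                                ∎)) cos[π]))
    (solve 0 (:- :- :1 := :1) ≈-refl)

  form-2 : form (fin 2) ≈ 0#
  form-2 = ≈-trans (-‿cong cos[π/2]) (solve 0 (:- :0 := :0) ≈-refl)

-- The bilinear form, the reflections and the relations they satisfy

module Geometry (em : ExcludedMiddle 0ℓ) (R : Reals) {n : ℕ} (M : CoxeterMatrix n) where
  open Words M public
  open RealField em R hiding (_≈_)
  open RealField em R using () renaming (_≈_ to _≈ℝ_)
  open Algebra.Properties.Semiring.Sum semiring
    using (sum; sum-cong-≋; *-distribˡ-sum; ∑-distrib-+; ∑-comm; sum-replicate-zero)

  V : Set
  V = Defs.V em R M

  infix 4 _≈ⱽ_
  _≈ⱽ_ : V → V → Set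
  _≈ⱽ_ = Defs._≈ⱽ_ em R M

  α : Fin n → V
  α = Defs.α em R M

  Bα : Fin n → Fin n → ℝ
  Bα = Defs.Bα em R M

  B : V → V → ℝ
  B = Defs.B em R M

  reflect : Fin n → V → V
  reflect = Defs.reflect em R M

  infixr 7 _•_
  _•_ : Word n → V → V
  _•_ = Defs._•_ em R M

  infixl 6 _+ⱽ_
  infixr 7 _*ⱽ_
  _+ⱽ_ : V → V → V
  (β +ⱽ γ) j = β j + γ j

  _*ⱽ_ : ℝ → V → V
  (c *ⱽ β) j = c * β j

  -ⱽ_ : V → V
  (-ⱽ β) j = - β j

  NonNegⱽ : V → Set
  NonNegⱽ β = ∀ j → NonNeg (β j)

  ⱽ-setoid : Setoid 0ℓ 0ℓ
  ⱽ-setoid = Data.Vec.Functional.Relation.Binary.Equality.Setoid.≋-setoid setoid n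

  module ℝ-Reasoning where
    open import Relation.Binary.Reasoning.Setoid setoid public
  module ⱽ-Reasoning where
    open import Relation.Binary.Reasoning.Setoid ⱽ-setoid public
  private module ⱽ = Setoid ⱽ-setoid
  open ⱽ public using () renaming (refl to ⱽ-refl; sym to ⱽ-sym; trans to ⱽ-trans; reflexive to ⱽ-reflexive)

  -ⱽ-cong : ∀ {β γ} → β ≈ⱽ γ → -ⱽ β ≈ⱽ -ⱽ γ
  -ⱽ-cong e j = -‿cong (e j)

  -ⱽ-involutive : ∀ β → β ≈ⱽ -ⱽ -ⱽ β
  -ⱽ-involutive β j = solve 1 (λ x → x := :- :- x) ≈-refl (β j)

  NonNegⱽ-resp : ∀ {β γ} → β ≈ⱽ γ → NonNegⱽ β → NonNegⱽ γ
  NonNegⱽ-resp e p j = NonNeg-resp (e j) (p j)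

  sum-0 : ∀ {k} (x : Fin k → ℝ) → (∀ i → x i ≈ℝ 0#) → sum x ≈ℝ 0#
  sum-0 {k} x e = ≈-trans (sum-cong-≋ e) (sum-replicate-zero k)

  sum-indicator : ∀ {k} (i : Fin k) (x : Fin k → ℝ) →
                  sum (λ j → (if does (i ≟ j) then 1# else 0#) * x j) ≈ℝ x i
  sum-indicator zero    x = ≈-trans (+-cong (*-identityˡ _) (sum-0 (λ j → 0# * x (suc j)) λ j → zeroˡ _)) (+-identityʳ _)
  sum-indicator (suc i) x = ≈-trans (+-cong (zeroˡ _) (sum-indicator i (λ j → x (suc j)))) (+-identityˡ _)

  Bα-form : ∀ i j → Bα i j ≡ form (m i j)
  Bα-form i j with m i j
  ... | fin k = refl
  ... | ∞     = refl

  Bα-sym : ∀ i j → Bα i j ≡ Bα j i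
  Bα-sym i j = ≡.trans (Bα-form i j) (≡.trans (cong form (symmetric i j)) (≡.sym (Bα-form j i)))

  Bα-diagonal : ∀ i → Bα i i ≈ℝ 1#
  Bα-diagonal i = ≈-trans (≈-reflexive (≡.trans (Bα-form i i) (cong form (diagonal i)))) form-1

  B-cong : ∀ {β β′ γ γ′} → β ≈ⱽ β′ → γ ≈ⱽ γ′ → B β γ ≈ℝ B β′ γ′
  B-cong e f = sum-cong-≋ λ i → sum-cong-≋ λ j → *-congʳ (*-cong (e i) (f j))

  B-sym : ∀ β γ → B β γ ≈ℝ B γ β
  B-sym β γ = ≈-trans (∑-comm (λ i j → β i * γ j * Bα i j))
    (sum-cong-≋ λ j → sum-cong-≋ λ i → *-cong (*-comm (β i) (γ j)) (≈-reflexive (Bα-sym i j)))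

  B-+ˡ : ∀ β γ δ → B (β +ⱽ γ) δ ≈ℝ B β δ + B γ δ
  B-+ˡ β γ δ = ≈-trans (sum-cong-≋ λ i → ≈-trans
    (sum-cong-≋ λ j → ≈-trans (*-congʳ (distribʳ (δ j) (β i) (γ i))) (distribʳ (Bα i j) _ _))
    (∑-distrib-+ (λ j → β i * δ j * Bα i j) (λ j → γ i * δ j * Bα i j)))
    (∑-distrib-+ (λ i → sum λ j → β i * δ j * Bα i j) (λ i → sum λ j → γ i * δ j * Bα i j))

  B-*ˡ : ∀ c β γ → B (c *ⱽ β) γ ≈ℝ c * B β γ
  B-*ˡ c β γ = ≈-sym (≈-trans (*-distribˡ-sum c (λ i → sum λ j → β i * γ j * Bα i j)) (sum-cong-≋ λ i →
    ≈-trans (*-distribˡ-sum c (λ j → β i * γ j * Bα i j)) (sum-cong-≋ λ j →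
      solve 4 (λ c b g x → c :* (b :* g :* x) := c :* b :* g :* x) ≈-refl c (β i) (γ j) (Bα i j))))

  B-+ʳ : ∀ β γ δ → B β (γ +ⱽ δ) ≈ℝ B β γ + B β δ
  B-+ʳ β γ δ = ≈-trans (B-sym β (γ +ⱽ δ)) (≈-trans (B-+ˡ γ δ β) (+-cong (B-sym γ β) (B-sym δ β)))

  B-*ʳ : ∀ c β γ → B β (c *ⱽ γ) ≈ℝ c * B β γ
  B-*ʳ c β γ = ≈-trans (B-sym β (c *ⱽ γ)) (≈-trans (B-*ˡ c γ β) (*-congˡ (B-sym γ β)))

  B-α : ∀ i j → B (α i) (α j) ≈ℝ Bα i j
  B-α i j = ≈-trans (sum-cong-≋ λ k → ≈-trans (sum-cong-≋ λ l → *-assoc (α i k) (α j l) (Bα k l))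
    (≈-sym (*-distribˡ-sum (α i k) (λ l → α j l * Bα k l))))
    (≈-trans (sum-indicator i (λ k → sum λ l → α j l * Bα k l)) (sum-indicator j (Bα i)))

  reflect≈ : ∀ i β → reflect i β ≈ⱽ β +ⱽ (- (2# * B β (α i))) *ⱽ α i
  reflect≈ i β j = solve 3 (λ b c a → b :- (:1 :+ :1) :* c :* a
    := b :+ (:- ((:1 :+ :1) :* c)) :* a) ≈-refl (β j) (B β (α i)) (α i j)

  reflect-cong : ∀ i {β γ} → β ≈ⱽ γ → reflect i β ≈ⱽ reflect i γ
  reflect-cong i e j = +-cong (e j) (-‿cong (*-congʳ (*-congˡ (B-cong e (ⱽ-refl {α i})))))

  reflect-+ : ∀ i β γ → reflect i (β +ⱽ γ) ≈ⱽ reflect i β +ⱽ reflect i γ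
  reflect-+ i β γ j = ≈-trans (+-congˡ (-‿cong (*-congʳ (*-congˡ (B-+ˡ β γ (α i))))))
    (solve 5 (λ b c x y a → (b :+ c) :- (:1 :+ :1) :* (x :+ y) :* a
      := (b :- (:1 :+ :1) :* x :* a) :+ (c :- (:1 :+ :1) :* y :* a))
      ≈-refl (β j) (γ j) (B β (α i)) (B γ (α i)) (α i j))

  reflect-* : ∀ i c β → reflect i (c *ⱽ β) ≈ⱽ c *ⱽ reflect i β
  reflect-* i c β j = ≈-trans (+-congˡ (-‿cong (*-congʳ (*-congˡ (B-*ˡ c β (α i))))))
    (solve 4 (λ c b x a → c :* b :- (:1 :+ :1) :* (c :* x) :* a
      := c :* (b :- (:1 :+ :1) :* x :* a)) ≈-refl c (β j) (B β (α i)) (α i j))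

  reflect-fixes : ∀ i {β} → B β (α i) ≈ℝ 0# → reflect i β ≈ⱽ β
  reflect-fixes i {β} e j = ≈-trans (+-congˡ (-‿cong (*-congʳ (*-congˡ e))))
    (solve 2 (λ b a → b :- (:1 :+ :1) :* :0 :* a := b) ≈-refl (β j) (α i j))

  reflect-α : ∀ i → reflect i (α i) ≈ⱽ -ⱽ α i
  reflect-α i j = ≈-trans (+-congˡ (-‿cong (*-congʳ (*-congˡ (≈-trans (B-α i i) (Bα-diagonal i))))))
    (solve 1 (λ a → a :- (:1 :+ :1) :* :1 :* a := :- a) ≈-refl (α i j))

  reflect-isometry : ∀ i β γ → B (reflect i β) (reflect i γ) ≈ℝ B β γ
  reflect-isometry i β γ = begin
    B (reflect i β) (reflect i γ)                 ≈⟨ B-cong (reflect≈ i β) (reflect≈ i γ) ⟩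
    B (β +ⱽ x *ⱽ α i) (γ +ⱽ y *ⱽ α i)             ≈⟨ B-+ˡ β (x *ⱽ α i) _ ⟩
    B β (γ +ⱽ y *ⱽ α i) + B (x *ⱽ α i) (γ +ⱽ y *ⱽ α i)
      ≈⟨ +-cong (B-+ʳ β γ (y *ⱽ α i)) (≈-trans (B-*ˡ x (α i) _) (*-congˡ (B-+ʳ (α i) γ (y *ⱽ α i)))) ⟩
    B β γ + B β (y *ⱽ α i) + x * (B (α i) γ + B (α i) (y *ⱽ α i))
      ≈⟨ +-cong (+-congˡ (B-*ʳ y β (α i))) (*-congˡ (+-cong (B-sym (α i) γ)
           (≈-trans (B-*ʳ y (α i) (α i)) (*-congˡ (≈-trans (B-α i i) (Bα-diagonal i)))))) ⟩
    B β γ + y * B β (α i) + x * (B γ (α i) + y * 1#)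
      ≈⟨ solve 3 (λ g p q → let x = :- ((:1 :+ :1) :* p)
                                y = :- ((:1 :+ :1) :* q) in
           g :+ y :* p :+ x :* (q :+ y :* :1) := g) ≈-refl (B β γ) (B β (α i)) (B γ (α i)) ⟩
    B β γ ∎
    where
    open ℝ-Reasoning
    x y : ℝ
    x = - (2# * B β (α i))
    y = - (2# * B γ (α i))

  •-++ : ∀ u v β → (u ++ v) • β ≡ u • v • β
  •-++ u v β = foldr-++ reflect β u v

  •-cong : ∀ w {β γ} → β ≈ⱽ γ → w • β ≈ⱽ w • γ
  •-cong []      e = e
  •-cong (i ∷ w) e = reflect-cong i (•-cong w e)

  •-+ : ∀ w β γ → w • (β +ⱽ γ) ≈ⱽ w • β +ⱽ w • γ
  •-+ []      β γ = ⱽ-refl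
  •-+ (i ∷ w) β γ = ⱽ-trans (reflect-cong i (•-+ w β γ)) (reflect-+ i (w • β) (w • γ))

  •-* : ∀ w c β → w • (c *ⱽ β) ≈ⱽ c *ⱽ w • β
  •-* []      c β = ⱽ-refl
  •-* (i ∷ w) c β = ⱽ-trans (reflect-cong i (•-* w c β)) (reflect-* i c (w • β))

  *ⱽ-cong : ∀ c {β γ} → β ≈ⱽ γ → c *ⱽ β ≈ⱽ c *ⱽ γ
  *ⱽ-cong c e j = *-congˡ (e j)

  -1*ⱽ : ∀ β → - 1# *ⱽ β ≈ⱽ -ⱽ β
  -1*ⱽ β j = solve 1 (λ b → :- :1 :* b := :- b) ≈-refl (β j)

  •-neg : ∀ w β → w • (-ⱽ β) ≈ⱽ -ⱽ (w • β)
  •-neg w β = ⱽ-trans (•-cong w (ⱽ-sym (-1*ⱽ β))) (ⱽ-trans (•-* w (- 1#) β) (-1*ⱽ (w • β)))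

  •-isometry : ∀ w β γ → B (w • β) (w • γ) ≈ℝ B β γ
  •-isometry []      β γ = ≈-refl
  •-isometry (i ∷ w) β γ = ≈-trans (reflect-isometry i (w • β) (w • γ)) (•-isometry w β γ)

  *ⱽ-cancelˡ : ∀ {c β γ} → ¬ c ≈ℝ 0# → c *ⱽ β ≈ⱽ c *ⱽ γ → β ≈ⱽ γ
  *ⱽ-cancelˡ {c} {β} {γ} c≉0 e j = +-difference-0 (*-cancelˡ-0 c≉0 (begin
    c * (β j - γ j)       ≈⟨ solve 3 (λ c b g → c :* (b :- g) := c :* b :- c :* g) ≈-refl c (β j) (γ j) ⟩
    c * β j - c * γ j     ≈⟨ +-congʳ (e j) ⟩
    c * γ j - c * γ j     ≈⟨ -‿inverseʳ _ ⟩
    0#                    ∎))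
    where open ℝ-Reasoning

  module Plane {ℓ : ℕ∞} (s : DihedralSequence ℓ) where
    open DihedralSequence s

    -- The roots of the dihedral subgroup scaled by `f 1`, indexed so that a reflection shifts the
    -- index by one and swaps `i` with `j`.
    vec : Fin n → Fin n → ℕ → V
    vec i j k = f (suc k) *ⱽ α i +ⱽ f k *ⱽ α j

    f[1]≉0 : ¬ f 1 ≈ℝ 0#
    f[1]≉0 = 0<⇒≉0 0<f[1]

    vec-0 : ∀ i j → vec i j 0 ≈ⱽ f 1 *ⱽ α i
    vec-0 i j k = ≈-trans (+-congˡ (≈-trans (*-congʳ f[0]) (zeroˡ _))) (+-identityʳ _)

    reflect-vec : ∀ {i j} → Bα i j ≈ℝ form ℓ → ∀ k → reflect j (vec i j k) ≈ⱽ vec j i (suc k)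
    reflect-vec {i} {j} e k l = begin
      x * α i l + y * α j l - 2# * B (vec i j k) (α j) * α j l
        ≈⟨ +-congˡ (-‿cong (*-congʳ (*-congˡ (≈-trans (B-+ˡ (x *ⱽ α i) (y *ⱽ α j) (α j)) (+-cong
             (≈-trans (B-*ˡ x (α i) (α j)) (*-congˡ (≈-trans (B-α i j) e)))
             (≈-trans (B-*ˡ y (α j) (α j)) (*-congˡ (≈-trans (B-α j j) (Bα-diagonal j))))))))) ⟩
      x * α i l + y * α j l - 2# * (x * form ℓ + y * 1#) * α j l
        ≈⟨ solve 5 (λ x y c a b → x :* a :+ y :* b :- (:1 :+ :1) :* (x :* c :+ y :* :1) :* b
             := (:- y :- (:1 :+ :1) :* c :* x) :* b :+ x :* a) ≈-refl x y (form ℓ) (α i l) (α j l) ⟩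
      (- y - 2# * form ℓ * x) * α j l + x * α i l
        ≈⟨ +-congʳ (*-congʳ (recurrence k)) ⟨
      vec j i (suc k) l ∎
      where
      open ℝ-Reasoning
      x y : ℝ
      x = f (suc k)
      y = f k

    ^-vec : ∀ {i j} → Bα i j ≈ℝ form ℓ → Bα j i ≈ℝ form ℓ →
            ∀ k l → (i ∷ j ∷ []) ^ k • vec i j l ≈ⱽ vec i j (k ℕ.* 2 ℕ.+ l)
    ^-vec         e e′ zero    l = ⱽ-refl
    ^-vec {i} {j} e e′ (suc k) l = ⱽ-trans
      (reflect-cong i (ⱽ-trans (reflect-cong j (^-vec e e′ k l)) (reflect-vec e (k ℕ.* 2 ℕ.+ l))))
      (reflect-vec e′ (suc (k ℕ.* 2 ℕ.+ l)))

    -- The last letter of the word is absorbed into the index `l`, with `i` and `j` exchanged and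
    -- `k + l` preserved. Once the word is used up, what remains is a combination of `v • α i` and
    -- `v • α j` whose coefficients are nonnegative because their indices do not exceed `ℓ`.
    alternating-vec : ∀ {i j} → Bα i j ≈ℝ form ℓ → Bα j i ≈ℝ form ℓ →
      ∀ k l v → fin (suc (k ℕ.+ l)) ≤⁺ ℓ → NonNegⱽ (v • α i) → NonNegⱽ (v • α j) →
      NonNegⱽ (v • alternating i j k • vec i j l)
    alternating-vec {i} {j} e e′ zero l v b p q = NonNegⱽ-resp (ⱽ-sym (ⱽ-trans
      (•-+ v (f (suc l) *ⱽ α i) (f l *ⱽ α j)) λ k → +-cong (•-* v (f (suc l)) (α i) k) (•-* v (f l) (α j) k)))
      λ k → NonNeg-+ (*-nonNeg (nonNeg b) (p k)) (*-nonNeg (nonNeg (pred-≤⁺ b)) (q k))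
    alternating-vec {i} {j} e e′ (suc k) l v b p q = NonNegⱽ-resp (ⱽ-trans
      (•-cong v (•-cong (alternating j i k) (ⱽ-sym (reflect-vec e l))))
      (ⱽ.reflexive (cong (v •_) (≡.sym (•-++ (alternating j i k) (j ∷ []) (vec i j l))))))
      (alternating-vec e′ e k (suc l) v (subst (λ l′ → fin (suc l′) ≤⁺ ℓ) (≡.sym (ℕ.+-suc k l)) b) q p)

  Fixes : Word n → V → Set
  Fixes w β = w • β ≈ⱽ β

  Fixes-resp : ∀ {w β γ} → β ≈ⱽ γ → Fixes w β → Fixes w γ
  Fixes-resp {w} e p = ⱽ-trans (•-cong w (ⱽ-sym e)) (ⱽ-trans p e)

  Fixes-+ : ∀ {w β γ} → Fixes w β → Fixes w γ → Fixes w (β +ⱽ γ)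
  Fixes-+ {w} p q = ⱽ-trans (•-+ w _ _) (λ j → +-cong (p j) (q j))

  Fixes-* : ∀ {w} c {β} → Fixes w β → Fixes w (c *ⱽ β)
  Fixes-* {w} c p = ⱽ-trans (•-* w c _) (*ⱽ-cong c p)

  Fixes-cancel : ∀ {w c β} → ¬ c ≈ℝ 0# → Fixes w (c *ⱽ β) → Fixes w β
  Fixes-cancel {w} {c} {β} c≉0 p = *ⱽ-cancelˡ c≉0 (ⱽ-trans (ⱽ-sym (•-* w c β)) p)

  -- For distinct `i` and `j` with a finite label, the plane they span is nondegenerate even if `B`
  -- is not. The orthogonal part of `β` is fixed by both reflections, and the plane is fixed because
  -- the relator shifts the dihedral sequence by a full period.
  •-relator : ∀ i j {k} → m i j ≡ fin k → ∀ β → Fixes ((i ∷ j ∷ []) ^ k) β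
  •-relator i j {k} e β with i ≟ j
  •-relator i .i {k} e β | yes refl with refl ← ≡.trans (≡.sym (diagonal i)) e = begin
      reflect i (reflect i β)                          ≈⟨ reflect-cong i (reflect≈ i β) ⟩
      reflect i (β +ⱽ c *ⱽ α i)                        ≈⟨ reflect-+ i β (c *ⱽ α i) ⟩
      reflect i β +ⱽ reflect i (c *ⱽ α i)
        ≈⟨ (λ j → +-cong (reflect≈ i β j) (reflect-* i c (α i) j)) ⟩
      β +ⱽ c *ⱽ α i +ⱽ c *ⱽ reflect i (α i)            ≈⟨ (λ j → +-congˡ (*-congˡ (reflect-α i j))) ⟩
      β +ⱽ c *ⱽ α i +ⱽ c *ⱽ (-ⱽ α i)
        ≈⟨ (λ j → solve 3 (λ b c a → b :+ c :* a :+ c :* :- a := b) ≈-refl (β j) c (α i j)) ⟩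
      β                                                ∎
      where
      open ⱽ-Reasoning
      c : ℝ
      c = - (2# * B β (α i))
  •-relator i j {k} e β | no i≢j with k | e | subst (fin 2 ≤⁺_) e (offDiagonal i j i≢j)
  ... | suc zero    | _ | [ ℕ.s≤s () ]
  ... | suc (suc d) | e | _ = Fixes-cancel {w} {D} D≉0 (Fixes-resp {w} (λ l →
        solve 4 (λ b p q r → (b :- p :- q) :+ p :+ q := b) ≈-refl (D * β l) ((x - b * y) * α i l) ((y - b * x) * α j l) 0#)
        (Fixes-+ {w} (Fixes-+ {w} orthogonal (Fixes-* {w} (x - b * y) fixes-αᵢ)) (Fixes-* {w} (y - b * x) fixes-αⱼ)))
    where
    open DihedralPeriod (period-fin d)
    open DihedralSequence (sequence-fin d)
    open Plane (sequence-fin d)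
    w : Word n
    w = (i ∷ j ∷ []) ^ suc (suc d)
    b x y D : ℝ
    b = form (fin (suc (suc d)))
    x = B β (α i)
    y = B β (α j)
    D = 1# - b * b
    D≉0 : ¬ D ≈ℝ 0#
    D≉0 p = f[1]≉0 (square-0 (≈-trans f[1]² p))
    Bᵢⱼ : Bα i j ≈ℝ b
    Bᵢⱼ = ≈-reflexive (≡.trans (Bα-form i j) (cong form e))
    Bⱼᵢ : Bα j i ≈ℝ b
    Bⱼᵢ = ≈-trans (≈-reflexive (Bα-sym j i)) Bᵢⱼ
    fixes-vec : ∀ k → Fixes w (vec i j k)
    fixes-vec k = ⱽ-trans (^-vec Bᵢⱼ Bⱼᵢ (suc (suc d)) k) λ l →
      +-cong (*-congʳ (≈-trans (≈-reflexive (cong f (≡.sym (ℕ.+-suc (suc (suc d) ℕ.* 2) k)))) (period (suc k))))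
             (*-congʳ (period k))
    fixes-αᵢ : Fixes w (α i)
    fixes-αᵢ = Fixes-cancel {w} f[1]≉0 (Fixes-resp {w} (vec-0 i j) (fixes-vec 0))
    fixes-αⱼ : Fixes w (α j)
    fixes-αⱼ = Fixes-cancel {w} f[1]≉0 (Fixes-resp {w}
      (λ l → solve 3 (λ x a y → (x :* a :+ y) :+ (:- x) :* a := y) ≈-refl (f 2) (α i l) (f 1 * α j l))
      (Fixes-+ {w} (fixes-vec 1) (Fixes-* {w} (- f 2) fixes-αᵢ)))
    -- `D` times the component of `β` orthogonal to the plane. The coefficients come from Cramer's
    -- rule for the Gram matrix with off-diagonal entry `b`; keeping the factor `D` avoids a
    -- division.
    γ : V
    γ l = D * β l - (x - b * y) * α i l - (y - b * x) * α j l
    B-γ : ∀ k {p q} → B (α i) (α k) ≈ℝ p → B (α j) (α k) ≈ℝ q →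
          B γ (α k) ≈ℝ D * B β (α k) - (x - b * y) * p - (y - b * x) * q
    B-γ k {p} {q} Bp Bq = begin
      B γ (α k)
        ≈⟨ B-cong (λ l → solve 5 (λ b p a q c → b :- p :* a :- q :* c := b :+ (:- p) :* a :+ (:- q) :* c)
             ≈-refl (D * β l) (x - b * y) (α i l) (y - b * x) (α j l)) (ⱽ-refl {α k}) ⟩
      B (D *ⱽ β +ⱽ r *ⱽ α i +ⱽ t *ⱽ α j) (α k)
        ≈⟨ ≈-trans (B-+ˡ (D *ⱽ β +ⱽ r *ⱽ α i) (t *ⱽ α j) (α k)) (+-congʳ (B-+ˡ (D *ⱽ β) (r *ⱽ α i) (α k))) ⟩
      B (D *ⱽ β) (α k) + B (r *ⱽ α i) (α k) + B (t *ⱽ α j) (α k)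
        ≈⟨ +-cong (+-cong (B-*ˡ D β (α k)) (≈-trans (B-*ˡ r (α i) (α k)) (*-congˡ Bp)))
                  (≈-trans (B-*ˡ t (α j) (α k)) (*-congˡ Bq)) ⟩
      D * B β (α k) + r * p + t * q
        ≈⟨ solve 5 (λ b r p t q → b :+ (:- r) :* p :+ (:- t) :* q := b :- r :* p :- t :* q)
             ≈-refl (D * B β (α k)) (x - b * y) p (y - b * x) q ⟩
      D * B β (α k) - (x - b * y) * p - (y - b * x) * q ∎
      where
      open ℝ-Reasoning
      r t : ℝ
      r = - (x - b * y)
      t = - (y - b * x)
    B-γᵢ : B γ (α i) ≈ℝ 0#
    B-γᵢ = ≈-trans (B-γ i (≈-trans (B-α i i) (Bα-diagonal i)) (≈-trans (B-α j i) Bⱼᵢ))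
      (solve 3 (λ b x y → (:1 :- b :* b) :* x :- (x :- b :* y) :* :1 :- (y :- b :* x) :* b := :0)
        ≈-refl b x y)
    B-γⱼ : B γ (α j) ≈ℝ 0#
    B-γⱼ = ≈-trans (B-γ j (≈-trans (B-α i j) Bᵢⱼ) (≈-trans (B-α j j) (Bα-diagonal j)))
      (solve 3 (λ b x y → (:1 :- b :* b) :* y :- (x :- b :* y) :* b :- (y :- b :* x) :* :1 := :0)
        ≈-refl b x y)
    fixed : ∀ k → Fixes ((i ∷ j ∷ []) ^ k) γ
    fixed zero    = ⱽ-refl
    fixed (suc k) = ⱽ-trans (reflect-cong i (ⱽ-trans (reflect-cong j (fixed k)) (reflect-fixes j B-γⱼ))) (reflect-fixes i B-γᵢ)
    orthogonal : Fixes w γ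
    orthogonal = fixed (suc (suc d))

  •-resp : ∀ {u v} → u ≋ v → ∀ β → u • β ≈ⱽ v • β
  •-resp (relator i j e) β = •-relator i j e β
  •-resp ≋-refl          β = ⱽ-refl
  •-resp (≋-sym p)       β = ⱽ-sym (•-resp p β)
  •-resp (≋-trans p q)   β = ⱽ-trans (•-resp p β) (•-resp q β)
  •-resp (++-cong {u} {u′} {v} {v′} p q) β = begin
    (u ++ v) • β     ≡⟨ •-++ u v β ⟩
    u • v • β        ≈⟨ •-cong u (•-resp q β) ⟩
    u • v′ • β       ≈⟨ •-resp p (v′ • β) ⟩
    u′ • v′ • β      ≡⟨ •-++ u′ v′ β ⟨
    (u′ ++ v′) • β   ∎
    where open ⱽ-Reasoning

-- Signs of roots, faithfulness and inversions

module Roots (em : ExcludedMiddle 0ℓ) (R : Reals) {n : ℕ} (M : CoxeterMatrix n) where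
  open Geometry em R M public
  open RealField em R hiding (_≈_)
  open RealField em R using () renaming (_≈_ to _≈ℝ_)

  α-diagonal : ∀ i → α i i ≡ 1#
  α-diagonal i with i ≟ i
  ... | yes _ = refl
  ... | no ne = contradiction refl ne

  α-offDiagonal : ∀ {i j} → i ≢ j → α i j ≡ 0#
  α-offDiagonal {i} {j} i≢j with i ≟ j
  ... | yes e = contradiction e i≢j
  ... | no _  = refl

  NonNegⱽ-α : ∀ i → NonNegⱽ (α i)
  NonNegⱽ-α i j with i ≟ j
  ... | yes _ = NonNeg-1
  ... | no _  = NonNeg-0

  NonPosⱽ : V → Set
  NonPosⱽ β = NonNegⱽ (-ⱽ β)

  reverse-cancels : ∀ w β → reverse w • w • β ≈ⱽ β
  reverse-cancels w β = ⱽ-trans (ⱽ-reflexive (≡.sym (•-++ (reverse w) w β))) (•-resp (G.inverseˡ w) β)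

  ¬α≈0 : ∀ i → ¬ (∀ j → α i j ≈ℝ 0#)
  ¬α≈0 i e = 0≉1 (≈-sym (≈-trans (≈-reflexive (≡.sym (α-diagonal i))) (e i)))

  root-nonzero : ∀ w i → NonNegⱽ (w • α i) → ¬ NonPosⱽ (w • α i)
  root-nonzero w i p q = ¬α≈0 i λ j → ≈-trans (≈-sym (reverse-cancels w (α i) j))
    (≈-trans (•-cong (reverse w) (λ k → ≈-trans (NonNeg-antisym (p k) (q k)) (≈-sym (zeroˡ 0#))) j)
    (≈-trans (•-* (reverse w) 0# (λ _ → 0#) j) (zeroˡ _)))

  •-snoc-α : ∀ w i → (w ++ i ∷ []) • α i ≈ⱽ -ⱽ (w • α i)
  •-snoc-α w i = ⱽ-trans (ⱽ-reflexive (•-++ w (i ∷ []) (α i)))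
    (ⱽ-trans (•-cong w (reflect-α i)) (•-neg w (α i)))

  -- The dihedral step is `alternating-vec` started at index 0, where the vector is `f 1` times
  -- `α i`; the positive factor is cancelled at the end.
  reduced-positive : ∀ w i → Reduced (w ++ i ∷ []) → NonNegⱽ (w • α i)
  reduced-positive = positivity em (λ w i → NonNegⱽ (w • α i))
    (λ {u} {v} {i} u≋v → NonNegⱽ-resp (•-resp u≋v (α i))) NonNegⱽ-α dihedral
    where
    dihedral : ∀ {i j} → i ≢ j → ∀ v k → NonNegⱽ (v • α i) → NonNegⱽ (v • α j) →
               fin (suc k) ≤⁺ m i j → NonNegⱽ ((v ++ alternating i j k) • α i)
    dihedral {i} {j} i≢j v k p q b l = NonNeg-cancelˡ (proj₁ 0<f[1]) f[1]≉0
      (NonNegⱽ-resp (ⱽ-trans (ⱽ-reflexive (≡.sym (•-++ v a (vec i j 0))))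
        (ⱽ-trans (•-cong (v ++ a) (vec-0 i j)) (•-* (v ++ a) (f 1) (α i))))
        (alternating-vec (≈-reflexive (Bα-form i j))
          (≈-reflexive (≡.trans (Bα-sym j i) (Bα-form i j))) k 0 v
          (subst (λ k → fin (suc k) ≤⁺ m i j) (≡.sym (ℕ.+-identityʳ k)) b) p q) l)
      where
      s = dihedralSequence (offDiagonal i j i≢j)
      open DihedralSequence s
      open Plane s
      a = alternating i j k

  ascent-or-descent : ∀ w i → ∃[ u ] Reduced (u ++ i ∷ []) × (u ≋ w ⊎ u ++ i ∷ [] ≋ w)
  ascent-or-descent w i with u , u≋w , r ← reducedWord em w with em {Reduced (u ++ i ∷ [])}
  ... | yes rᵢ = u , rᵢ , inj₁ u≋w
  ... | no ¬rᵢ with v , v≋u , e ← descent em r ¬rᵢ =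
        v , Reduced-resp v≋u (≡.trans (≡.trans (length-++ v) (ℕ.+-comm (length v) 1)) e) r , inj₂ (G.trans v≋u u≋w)

  dichotomy : ∀ w i → NonNegⱽ (w • α i) ⊎ NonPosⱽ (w • α i)
  dichotomy w i with ascent-or-descent w i
  ... | u , r , inj₁ u≋w = inj₁ (NonNegⱽ-resp (•-resp u≋w (α i)) (reduced-positive u i r))
  ... | u , r , inj₂ e   = inj₂ (NonNegⱽ-resp (ⱽ-trans (-ⱽ-involutive (u • α i))
          (-ⱽ-cong (ⱽ-trans (ⱽ-sym (•-snoc-α u i)) (•-resp e (α i))))) (reduced-positive u i r))

  -- If a reduced form of `w` ended in `j`, it would send `α j` to a nonpositive vector, although it
  -- acts trivially and `α j` is nonnegative.
  faithful : ∀ w → (∀ β → w • β ≈ⱽ β) → w ≋ []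
  faithful w fixes with u , u≋w , r ← reducedWord em w with initLast u
  ... | []      = G.sym u≋w
  ... | u ∷ʳ′ j = contradiction
    (NonNegⱽ-resp (ⱽ-trans (-ⱽ-involutive (u • α j))
      (-ⱽ-cong (ⱽ-trans (ⱽ-sym (•-snoc-α u j)) (ⱽ-trans (•-resp u≋w (α j)) (fixes (α j))))))
      (reduced-positive u j r))
    (root-nonzero [] j (NonNegⱽ-α j))

  faithful₂ : ∀ u v → (∀ β → u • β ≈ⱽ v • β) → u ≋ v
  faithful₂ u v e = G-props.x∙y⁻¹≈ε⇒x≈y u v (faithful (u ++ reverse v) λ β →
    ⱽ-trans (ⱽ-reflexive (•-++ u (reverse v) β)) (ⱽ-trans (e (reverse v • β))
      (ⱽ-trans (ⱽ-reflexive (≡.sym (•-++ v (reverse v) β))) (•-resp (G.inverseʳ v) β))))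
    where module G-props = Algebra.Properties.Group (coxeterGroup M)

  -- Conjugating a reflection by an isometry gives the reflection in the image root; faithfulness
  -- turns this equality of actions into one in the group.
  reflection-conjugate : ∀ w {i j} → w • α i ≈ⱽ α j → w ++ i ∷ [] ≋ j ∷ w
  reflection-conjugate w {i} {j} e = faithful₂ (w ++ i ∷ []) (j ∷ w) λ β → begin
    (w ++ i ∷ []) • β                                         ≡⟨ •-++ w (i ∷ []) β ⟩
    w • reflect i β                                           ≈⟨ •-cong w (reflect≈ i β) ⟩
    w • (β +ⱽ (- (2# * B β (α i))) *ⱽ α i)                    ≈⟨ •-+ w β _ ⟩
    w • β +ⱽ w • (- (2# * B β (α i))) *ⱽ α i                  ≈⟨ (λ k → +-congˡ (•-* w _ (α i) k)) ⟩
    w • β +ⱽ (- (2# * B β (α i))) *ⱽ w • α i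
      ≈⟨ (λ k → +-congˡ (*-cong (-‿cong (*-congˡ (≈-trans (≈-sym (•-isometry w β (α i))) (B-cong (ⱽ-refl {w • β}) e)))) (e k))) ⟩
    w • β +ⱽ (- (2# * B (w • β) (α j))) *ⱽ α j                ≈⟨ reflect≈ j (w • β) ⟨
    reflect j (w • β)                                         ∎
    where open ⱽ-Reasoning

  -- A simple reflection alters only the coordinate `j`, so all others must vanish when the sign
  -- flips. The root is then `c` times `α j`, and invariance of its norm with `c` nonnegative forces
  -- `c` to be 1.
  simple-inversion : ∀ w i j → NonNegⱽ (w • α i) → NonPosⱽ (reflect j (w • α i)) → w • α i ≈ⱽ α j
  simple-inversion w i j p q k = ≈-trans (proportional k) (≈-trans (*-congʳ c≈1) (*-identityˡ _))
    where
    open ℝ-Reasoning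
    δ : V
    δ = w • α i
    c : ℝ
    c = δ j
    proportional : δ ≈ⱽ c *ⱽ α j
    proportional k with j ≟ k
    ... | yes refl = ≈-sym (*-identityʳ c)
    ... | no j≢k   = ≈-trans (NonNeg-antisym (p k) (NonNeg-resp (-‿cong (begin
        δ k - 2# * B δ (α j) * α j k  ≡⟨ cong (λ x → δ k - 2# * B δ (α j) * x) (α-offDiagonal j≢k) ⟩
        δ k - 2# * B δ (α j) * 0#     ≈⟨ solve 2 (λ d x → d :- x :* :0 := d) ≈-refl _ _ ⟩
        δ k                           ∎)) (q k))) (≈-sym (zeroʳ c))
    c²≈1 : c * c ≈ℝ 1#
    c²≈1 = begin
      c * c                         ≈⟨ solve 1 (λ c → c :* c := c :* (c :* :1)) ≈-refl c ⟩
      c * (c * 1#)                  ≈⟨ *-congˡ (*-congˡ (≈-trans (B-α j j) (Bα-diagonal j))) ⟨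
      c * (c * B (α j) (α j))       ≈⟨ *-congˡ (B-*ʳ c (α j) (α j)) ⟨
      c * B (α j) (c *ⱽ α j)        ≈⟨ B-*ˡ c (α j) (c *ⱽ α j) ⟨
      B (c *ⱽ α j) (c *ⱽ α j)       ≈⟨ B-cong proportional proportional ⟨
      B δ δ                         ≈⟨ •-isometry w (α i) (α i) ⟩
      B (α i) (α i)                 ≈⟨ ≈-trans (B-α i i) (Bα-diagonal i) ⟩
      1#                            ∎
    c≈1 : c ≈ℝ 1#
    c≈1 = +-difference-0 (*-cancelˡ-0
      (λ e → ¬NonNeg-‿1 (NonNeg-resp (≈-trans (solve 1 (λ c → c := (c :+ :1) :- :1) ≈-refl c)
               (≈-trans (+-congʳ e) (+-identityˡ _))) (p j)))
      (begin
        (c + 1#) * (c - 1#)  ≈⟨ solve 1 (λ c → (c :+ :1) :* (c :- :1) := c :* c :- :1) ≈-refl c ⟩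
        c * c - 1#           ≈⟨ +-congʳ c²≈1 ⟩
        1# - 1#              ≈⟨ -‿inverseʳ 1# ⟩
        0#                   ∎))

  Orthogonal : Fin n → Fin n → Set
  Orthogonal i j = B (α j) (α i) ≈ℝ 0#

  fixes-orthogonal : ∀ j {w} → All (λ i → Orthogonal i j) w → Fixes w (α j)
  fixes-orthogonal j []                   = ⱽ-refl
  fixes-orthogonal j {w = i ∷ w} (o ∷ os) = ⱽ-trans (reflect-cong i (fixes-orthogonal j os)) (reflect-fixes i o)

  -- Look at which letter makes the root negative, reading `w` from the right. By `simple-inversion`
  -- the root has become the simple root of that letter; the letters applied before it are
  -- orthogonal to it and fix it, so the root was this simple root from the start.
  orthogonal-inversion : ∀ w → AllPairs (λ j i → Orthogonal i j) w → ∀ v i →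
    NonNegⱽ (v • α i) → NonPosⱽ (w • v • α i) → ∃[ j ] j ∈ w × v • α i ≈ⱽ α j
  orthogonal-inversion []      []       v i p q = contradiction q (root-nonzero v i p)
  orthogonal-inversion (j ∷ w) (o ∷ os) v i p q with dichotomy (w ++ v) i
  ... | inj₂ q′ with k , k∈w , e ← orthogonal-inversion w os v i p
          (NonNegⱽ-resp (-ⱽ-cong (ⱽ-reflexive (•-++ w v (α i)))) q′)
    = k , there k∈w , e
  ... | inj₁ p′ = j , here refl , (begin
    v • α i                         ≈⟨ reverse-cancels w (v • α i) ⟨
    reverse w • w • v • α i         ≈⟨ •-cong (reverse w) w•v•α≈α ⟩
    reverse w • α j                 ≈⟨ •-cong (reverse w) (fixes-orthogonal j o) ⟨
    reverse w • w • α j             ≈⟨ reverse-cancels w (α j) ⟩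
    α j                             ∎)
    where
    open ⱽ-Reasoning
    w•v•α≈α : w • v • α i ≈ⱽ α j
    w•v•α≈α = ⱽ-trans (ⱽ-reflexive (≡.sym (•-++ w v (α i)))) (simple-inversion (w ++ v) i j p′
      (NonNegⱽ-resp (-ⱽ-cong (reflect-cong j (ⱽ-reflexive (≡.sym (•-++ w v (α i)))))) q))

-- Supports and nonnegative combinations of simple roots

module Positivity (em : ExcludedMiddle 0ℓ) (R : Reals) {n : ℕ} (M : CoxeterMatrix n) where
  open Roots em R M public
  open RealField em R hiding (_≈_)
  open RealField em R using () renaming (_≈_ to _≈ℝ_)
  open Algebra.Properties.Semiring.Sum semiring using (sum; sum-cong-≋)

  α-injective : ∀ {i j} → α i ≈ⱽ α j → i ≡ j
  α-injective {i} {j} e with i ≟ j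
  ... | yes i≡j = i≡j
  ... | no i≢j  = contradiction (≈-trans (≈-reflexive (≡.sym (α-offDiagonal i≢j)))
                    (≈-trans (e j) (≈-reflexive (α-diagonal j)))) 0≉1

  α-sym : ∀ i j → α i j ≡ α j i
  α-sym i j with i ≟ j
  ... | yes refl = ≡.sym (α-diagonal i)
  ... | no i≢j   = ≡.sym (α-offDiagonal (i≢j ∘ ≡.sym))

  •-outside : ∀ {w l} β → All (_≢ l) w → (w • β) l ≈ℝ β l
  •-outside               β []       = ≈-refl
  •-outside {i ∷ w} {l} β (p ∷ ps) = ≈-trans
    (≈-trans (+-congˡ (-‿cong (*-congˡ (≈-reflexive (α-offDiagonal p)))))
             (solve 2 (λ d x → d :- x :* :0 := d) ≈-refl _ _))
    (•-outside β ps)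

  -- The index set `Fin k` with labels `b` is kept separate from `Fin n` so that an induction on `k`
  -- can drop the first term.
  combination : ∀ {k} → (Fin k → ℝ) → (Fin k → Fin n) → V
  combination x b l = sum λ t → x t * α (b t) l

  •-combination : ∀ w {k} (x : Fin k → ℝ) (b : Fin k → Fin n) → (∀ t → NonNeg (x t)) →
    (∀ t → x t ≈ℝ 0# ⊎ NonNegⱽ (w • α (b t))) → NonNegⱽ (w • combination x b)
  •-combination w {zero}  x b p q l = NonNeg-resp
    (≈-sym (≈-trans (•-cong w (λ _ → ≈-sym (zeroˡ 0#)) l) (≈-trans (•-* w 0# (λ _ → 0#) l) (zeroˡ _)))) NonNeg-0
  •-combination w {suc k} x b p q = NonNegⱽ-resp
    (ⱽ-sym (ⱽ-trans (•-+ w (x zero *ⱽ α (b zero)) (combination (x ∘ suc) (b ∘ suc)))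
      (λ l → +-congʳ (•-* w (x zero) (α (b zero)) l))))
    (λ l → NonNeg-+ (first (q zero) l) (•-combination w (x ∘ suc) (b ∘ suc) (p ∘ suc) (q ∘ suc) l))
    where
    first : x zero ≈ℝ 0# ⊎ NonNegⱽ (w • α (b zero)) → ∀ l → NonNeg (x zero * (w • α (b zero)) l)
    first (inj₁ e) l = NonNeg-resp (≈-sym (≈-trans (*-congʳ e) (zeroˡ _))) NonNeg-0
    first (inj₂ r) l = *-nonNeg (p zero) (r l)

  -- By linearity: `β` is the combination of simple roots with its own coordinates, and terms
  -- outside its support vanish.
  •-nonNeg : ∀ w {β} → NonNegⱽ β → (∀ j → β j ≈ℝ 0# ⊎ NonNegⱽ (w • α j)) → NonNegⱽ (w • β)
  •-nonNeg w {β} p q = NonNegⱽ-resp (•-cong w {combination β λ j → j} λ l → ≈-trans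
      (sum-cong-≋ λ t → ≈-trans (*-comm (β t) (α t l)) (*-congʳ (≈-reflexive (α-sym t l))))
      (sum-indicator l β))
    (•-combination w β (λ j → j) p q)

-- The homomorphism φ and the action of the diagram automorphism

module Folding (em : ExcludedMiddle 0ℓ) (R : Reals) {n n′ : ℕ} {M : CoxeterMatrix n}
               {M′ : CoxeterMatrix n′} (folding : IsFolding M M′) where
  open Positivity em R M public
  open RealField em R hiding (_≈_)
  open RealField em R using () renaming (_≈_ to _≈ℝ_)
  open Algebra.Properties.Semiring.Sum semiring using (sum; sum-cong-≋; ∑-permute)
  module W′ = Positivity em R M′
  open IsFolding folding public

  orbit : Fin n′ → Word n
  orbit = orbitProduct orb

  ∈-orbit⁺ : ∀ {i o} → orb i ≡ o → i ∈ orbit o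
  ∈-orbit⁺ {i} {o} e = ∈-filter⁺ (λ i → orb i ≟ o) (∈-allFin i) e

  ∈-orbit⁻ : ∀ {i o} → i ∈ orbit o → orb i ≡ o
  ∈-orbit⁻ {i} {o} i∈ = proj₂ (∈-filter⁻ (λ i → orb i ≟ o) {xs = allFin n} i∈)

  all-orbit : ∀ o → All (λ i → orb i ≡ o) (orbit o)
  all-orbit o = All.tabulate ∈-orbit⁻

  orbit-unique : ∀ o → Unique (orbit o)
  orbit-unique o = Unique.filter⁺ (λ i → orb i ≟ o) (Unique.allFin⁺ n)

  commutes : ∀ {i j} → i ≢ j → orb i ≡ orb j → m i j ≡ fin 2
  commutes {i} {j} i≢j e = go (m i j) refl (offDiagonal i j i≢j)
    where
    go : ∀ ℓ → m i j ≡ ℓ → fin 2 ≤⁺ ℓ → m i j ≡ fin 2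
    go ∞       p _     = contradiction (∞ , i≢j , p , (_ ≤⊤⁺)) (independent i j e)
    go (fin k) p [ q ] with k ℕ.≟ 2
    ... | yes refl = p
    ... | no k≢2   = contradiction (fin k , i≢j , p , [ ℕ.≤∧≢⇒< q (k≢2 ∘ ≡.sym) ]) (independent i j e)

  orthogonal : ∀ {i j} → i ≢ j → orb i ≡ orb j → Orthogonal i j
  orthogonal {i} {j} i≢j e = ≈-trans (B-α j i) (≈-trans (≈-reflexive (≡.trans (Bα-form j i)
    (cong form (commutes (i≢j ∘ ≡.sym) (≡.sym e))))) form-2)

  orthogonal-list : ∀ {o w} → All (λ i → orb i ≡ o) w → Unique w → AllPairs (λ j i → Orthogonal i j) w
  orthogonal-list []       []       = []
  orthogonal-list (p ∷ ps) (u ∷ us) =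
    All.map (λ (i≢ , e) → orthogonal (i≢ ∘ ≡.sym) (≡.trans e (≡.sym p))) (All.zip (u , ps)) ∷ orthogonal-list ps us

  permuted : ∀ {o u v} → u ↭ v → All (λ i → orb i ≡ o) u → u ≋ v
  permuted ↭.refl         ps           = G.refl
  permuted (↭.prep x p)   (_ ∷ ps)     = G.∙-congˡ {x ∷ []} (permuted p ps)
  permuted {u = x ∷ y ∷ u} {v = y ∷ x ∷ v} (↭.swap x y p) (e ∷ f ∷ ps) = ++-cong (swapped (x ≟ y)) (permuted p ps)
    where
    swapped : _ → x ∷ y ∷ [] ≋ y ∷ x ∷ []
    swapped (yes refl) = G.refl
    swapped (no x≢y)   = alternating-relation (commutes x≢y (≡.trans e (≡.sym f)))
  permuted (↭.trans p q) ps           = G.trans (permuted p ps) (permuted q (All-resp-↭ p ps))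

  φ : Word n′ → Word n
  φ = concatMap orbit

  φ-++ : ∀ u v → φ (u ++ v) ≡ φ u ++ φ v
  φ-++ = concatMap-++ orbit

  φ-∷ : ∀ x o → φ (x ++ o ∷ []) ≡ φ x ++ orbit o
  φ-∷ x o = ≡.trans (φ-++ x (o ∷ [])) (cong (φ x ++_) (++-identityʳ (orbit o)))

  φ-^ : ∀ o o′ k → φ ((o ∷ o′ ∷ []) ^ k) ≡ (orbit o ++ orbit o′) ^ k
  φ-^ o o′ zero    = refl
  φ-^ o o′ (suc k) = ≡.trans (≡.sym (++-assoc (orbit o) (orbit o′) _))
                             (cong ((orbit o ++ orbit o′) ++_) (φ-^ o o′ k))

  -- A relator goes to a power of a product of two orbit products, and its exponent is the order of
  -- that product by the definition of the folding.
  φ-resp : ∀ {u v} → u W′.≋ v → φ u ≋ φ v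
  φ-resp (relator o o′ {k} e) = G.trans (≡⇒≋ (φ-^ o o′ k))
    (proj₁ (proj₂ (subst (HasOrder M (orbit o ++ orbit o′)) e (order o o′))))
  φ-resp ≋-refl        = G.refl
  φ-resp (≋-sym p)     = G.sym (φ-resp p)
  φ-resp (≋-trans p q) = G.trans (φ-resp p) (φ-resp q)
  φ-resp (++-cong {u} {u′} {v} {v′} p q) =
    G.trans (≡⇒≋ (φ-++ u v)) (G.trans (++-cong (φ-resp p) (φ-resp q)) (≡⇒≋ (≡.sym (φ-++ u′ v′))))

  σ⁺ σ⁻ : Fin n → Fin n
  σ⁺ = σ ⟨$⟩ʳ_
  σ⁻ = σ ⟨$⟩ˡ_

  σ-injective : ∀ {i j} → σ⁺ i ≡ σ⁺ j → i ≡ j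
  σ-injective e = ≡.trans (≡.sym (inverseˡ σ)) (≡.trans (cong σ⁻ e) (inverseˡ σ))

  orb-σ : ∀ i → orb (σ⁺ i) ≡ orb i
  orb-σ i = ≡.sym (Equivalence.from (orbits i (σ⁺ i)) (1 , refl))

  -- `automorphism` speaks only of edges, whose labels are at least 3. Both of its directions are
  -- used, so that label 2 is matched as the absence of an edge.
  m-σ : ∀ i j → m (σ⁺ i) (σ⁺ j) ≡ m i j
  m-σ i j with i ≟ j
  ... | yes refl = ≡.trans (diagonal (σ⁺ i)) (≡.sym (diagonal i))
  ... | no i≢j   = compare (m i j) (m (σ⁺ i) (σ⁺ j)) refl refl
                     (offDiagonal i j i≢j) (offDiagonal (σ⁺ i) (σ⁺ j) (i≢j ∘ σ-injective))
    where
    label : ∀ {ℓ} → fin 2 ≤⁺ ℓ → ℓ ≡ fin 2 ⊎ fin 3 ≤⁺ ℓ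
    label (_ ≤⊤⁺)   = inj₂ (_ ≤⊤⁺)
    label {fin k} [ p ] with k ℕ.≟ 2
    ... | yes refl = inj₁ refl
    ... | no k≢2   = inj₂ [ ℕ.≤∧≢⇒< p (k≢2 ∘ ≡.sym) ]
    compare : ∀ ℓ ℓ′ → m i j ≡ ℓ → m (σ⁺ i) (σ⁺ j) ≡ ℓ′ → fin 2 ≤⁺ ℓ → fin 2 ≤⁺ ℓ′ →
              m (σ⁺ i) (σ⁺ j) ≡ m i j
    compare ℓ ℓ′ e e′ p p′ = case label p , label p′ of λ where
      (inj₂ q , _) → ≡.trans (proj₁ (proj₂ (Equivalence.to (automorphism i j ℓ) (i≢j , e , q)))) (≡.sym e)
      (inj₁ _ , inj₂ q) → ≡.trans e′ (≡.sym (proj₁ (proj₂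
        (Equivalence.from (automorphism i j ℓ′) (i≢j ∘ σ-injective , e′ , q)))))
      (inj₁ f , inj₁ f′) → ≡.trans (≡.trans e′ f′) (≡.sym (≡.trans e f))

  -- Being precomposition, this is the linear map induced by the inverse of σ: it sends `α (σ⁺ i)`
  -- to `α i`. It only permutes coordinates, so it preserves nonnegativity.
  σ*_ : V → V
  (σ* β) i = β (σ⁺ i)

  σ*-α : ∀ i → σ* α (σ⁺ i) ≈ⱽ α i
  σ*-α i j with i ≟ j
  ... | yes refl = ≈-reflexive (α-diagonal (σ⁺ i))
  ... | no i≢j   = ≈-reflexive (α-offDiagonal (i≢j ∘ σ-injective))

  σ*-isometry : ∀ β γ → B (σ* β) (σ* γ) ≈ℝ B β γ
  σ*-isometry β γ = ≈-sym (≈-trans (∑-permute (λ i → sum λ j → β i * γ j * Bα i j) σ) (sum-cong-≋ λ i →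
    ≈-trans (∑-permute (λ j → β (σ⁺ i) * γ j * Bα (σ⁺ i) j) σ) (sum-cong-≋ λ j → *-congˡ (≈-reflexive
      (≡.trans (Bα-form (σ⁺ i) (σ⁺ j)) (≡.trans (cong form (m-σ i j)) (≡.sym (Bα-form i j))))))))

  σ*-reflect : ∀ i β → σ* reflect (σ⁺ i) β ≈ⱽ reflect i (σ* β)
  σ*-reflect i β j = +-congˡ (-‿cong (*-cong (*-congˡ
    (≈-trans (≈-sym (σ*-isometry β (α (σ⁺ i)))) (B-cong (ⱽ-refl {σ* β}) (σ*-α i)))) (σ*-α i j)))

  σ*-• : ∀ w β → σ* (map σ⁺ w • β) ≈ⱽ w • σ* β
  σ*-• []      β = ⱽ-refl
  σ*-• (i ∷ w) β = ⱽ-trans (σ*-reflect i (map σ⁺ w • β)) (reflect-cong i (σ*-• w β))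

  map-σ-orbit : ∀ o → map σ⁺ (orbit o) ≋ orbit o
  map-σ-orbit o = permuted (∼bag⇒↭ (unique∧set⇒bag (Unique.map⁺ σ-injective (orbit-unique o)) (orbit-unique o)
      (mk⇔ to from))) all-map
    where
    all-map : All (λ i → orb i ≡ o) (map σ⁺ (orbit o))
    all-map = All.map⁺ (All.map (λ {i} e → ≡.trans (orb-σ i) e) (all-orbit o))
    to : ∀ {i} → i ∈ map σ⁺ (orbit o) → i ∈ orbit o
    to i∈ = ∈-orbit⁺ (All.lookup all-map i∈)
    from : ∀ {i} → i ∈ orbit o → i ∈ map σ⁺ (orbit o)
    from {i} i∈ = subst (_∈ map σ⁺ (orbit o)) (inverseʳ σ) (∈-map⁺ σ⁺ (∈-orbit⁺
      (≡.trans (≡.sym (orb-σ (σ⁻ i))) (≡.trans (cong orb (inverseʳ σ)) (∈-orbit⁻ i∈)))))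

  -- Relabelling an orbit product by σ only reorders commuting factors, so everything in the image
  -- of φ commutes with σ.
  σ*-φ : ∀ x β → σ* (φ x • β) ≈ⱽ φ x • σ* β
  σ*-φ []      β = ⱽ-refl
  σ*-φ (o ∷ x) β = begin
    σ* ((orbit o ++ φ x) • β)              ≡⟨ cong σ*_ (•-++ (orbit o) (φ x) β) ⟩
    σ* (orbit o • φ x • β)                 ≈⟨ (λ j → •-resp (map-σ-orbit o) (φ x • β) (σ⁺ j)) ⟨
    σ* (map σ⁺ (orbit o) • φ x • β)        ≈⟨ σ*-• (orbit o) (φ x • β) ⟩
    orbit o • σ* (φ x • β)                 ≈⟨ •-cong (orbit o) (σ*-φ x β) ⟩
    orbit o • φ x • σ* β                   ≡⟨ •-++ (orbit o) (φ x) (σ* β) ⟨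
    (orbit o ++ φ x) • σ* β                ∎
    where open ⱽ-Reasoning

  φ-α-σ : ∀ x i → φ x • α i ≈ⱽ σ* (φ x • α (σ⁺ i))
  φ-α-σ x i = ⱽ-trans (•-cong (φ x) (ⱽ-sym (σ*-α i))) (ⱽ-sym (σ*-φ x (α (σ⁺ i))))

-- Signs of folded roots

module FoldedRoots (em : ExcludedMiddle 0ℓ) (R : Reals) {n n′ : ℕ} {M : CoxeterMatrix n}
                   {M′ : CoxeterMatrix n′} (folding : IsFolding M M′) where
  open Folding em R folding public
  open RealField em R hiding (_≈_)
  open RealField em R using () renaming (_≈_ to _≈ℝ_)

  Positive : Word n′ → Fin n′ → Set
  Positive x o = ∀ i → orb i ≡ o → NonNegⱽ (φ x • α i)

  NonNegⱽ-φ-σ : ∀ x i t → NonNegⱽ (φ x • α (fold i σ⁺ t)) → NonNegⱽ (φ x • α i)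
  NonNegⱽ-φ-σ x i zero    p = p
  NonNegⱽ-φ-σ x i (suc t) p = NonNegⱽ-φ-σ x i t (NonNegⱽ-resp (ⱽ-sym (φ-α-σ x (fold i σ⁺ t))) (λ j → p (σ⁺ j)))

  -- σ commutes with `φ x` and is transitive on an orbit, so all members of the orbit share one
  -- sign. Consequently, if `Positive x o` fails, then all of them become negative.
  NonNegⱽ⇒Positive : ∀ x {o} i → orb i ≡ o → NonNegⱽ (φ x • α i) → Positive x o
  NonNegⱽ⇒Positive x i e p j f with t , g ← Equivalence.to (orbits j i) (≡.trans f (≡.sym e)) =
    NonNegⱽ-φ-σ x j t (subst (λ k → NonNegⱽ (φ x • α k)) (≡.sym g) p)

  Positive-[] : ∀ o → Positive [] o
  Positive-[] o i _ = NonNegⱽ-α i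

  Positive-resp : ∀ {x y o} → x W′.≋ y → Positive x o → Positive y o
  Positive-resp e p i f = NonNegⱽ-resp (•-resp (φ-resp e) (α i)) (p i f)

  module _ {x : Word n′} {o o′ : Fin n′} (positive : Positive x o)
           (negative : ∀ i → orb i ≡ o → NonPosⱽ (orbit o′ • φ x • α i)) where
    private
      _↦_ : Fin n → Fin n → Set
      i ↦ j = φ x • α i ≈ⱽ α j

    image : ∀ i → orb i ≡ o → ∃[ j ] orb j ≡ o′ × i ↦ j
    image i e with j , j∈ , f ← orthogonal-inversion (orbit o′) (orthogonal-list (all-orbit o′) (orbit-unique o′))
                                  (φ x) i (positive i e) (negative i e) = j , ∈-orbit⁻ j∈ , f

    -- One step back along the orbit: if `i` goes to `σ⁺ j`, then `σ⁻ i` goes to `j`, since `φ x`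
    -- commutes with σ.
    preimage-σ : ∀ t {i j} k → orb i ≡ o → i ↦ j → fold k σ⁺ t ≡ j → ∃[ l ] orb l ≡ o × l ↦ k
    preimage-σ zero    {i} k e f refl = i , e , f
    preimage-σ (suc t) {i} k e f refl = preimage-σ t {σ⁻ i} k
      (≡.trans (≡.sym (orb-σ (σ⁻ i))) (≡.trans (cong orb (inverseʳ σ)) e))
      (ⱽ-trans (φ-α-σ x (σ⁻ i)) (ⱽ-trans
        (λ j → subst (λ l → (φ x • α l) (σ⁺ j) ≈ℝ α (σ⁺ (fold k σ⁺ t)) (σ⁺ j)) (≡.sym (inverseʳ σ)) (f (σ⁺ j)))
        (σ*-α (fold k σ⁺ t))))
      refl

    -- One image `k` in `o′` is enough: the images are stable under σ, and σ is transitive on `o′`.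
    preimage : ∀ j → orb j ≡ o′ → ∃[ i ] orb i ≡ o × i ↦ j
    preimage j e with i , f ← surjective o with k , g , h ← image i f
      with t , p ← Equivalence.to (orbits j k) (≡.trans e (≡.sym g)) = preimage-σ t j f h p

    images : ∀ {is} → All (λ i → orb i ≡ o) is → ∃[ js ] All (λ j → orb j ≡ o′) js × Pointwise _↦_ is js
    images []                = [] , [] , []
    images {i ∷ is} (p ∷ ps) with j , q , f ← image i p with js , qs , fs ← images ps =
      j ∷ js , q ∷ qs , f ∷ fs

    conjugate : ∀ {is js} → Pointwise _↦_ is js → φ x ++ is ≋ js ++ φ x
    conjugate []       = ≡⇒≋ (++-identityʳ (φ x))
    conjugate {i ∷ is} {j ∷ js} (f ∷ fs) = G.trans (≡⇒≋ (≡.sym (++-assoc (φ x) (i ∷ []) is)))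
      (G.trans (G.∙-congʳ {is} (reflection-conjugate (φ x) f)) (G.∙-congˡ {j ∷ []} (conjugate fs)))

    ↦-injective : ∀ {i i′ j} → i ↦ j → i′ ↦ j → i ≡ i′
    ↦-injective {i} {i′} f f′ = α-injective (ⱽ-trans (ⱽ-sym (reverse-cancels (φ x) (α i)))
      (ⱽ-trans (•-cong (reverse (φ x)) (ⱽ-trans f (ⱽ-sym f′))) (reverse-cancels (φ x) (α i′))))

    images-fresh : ∀ {i j is js} → i ↦ j → All (i ≢_) is → Pointwise _↦_ is js → All (j ≢_) js
    images-fresh f []         []         = []
    images-fresh {j = j} f (i≢ ∷ i≢s) (f′ ∷ fs′) =
      (λ { refl → i≢ (↦-injective {j = j} f f′) }) ∷ images-fresh f i≢s fs′

    images-unique : ∀ {is js} → Unique is → Pointwise _↦_ is js → Unique js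
    images-unique []       []       = []
    images-unique (u ∷ us) (f ∷ fs) = images-fresh f u fs ∷ images-unique us fs

    images-complete : ∀ {i j is js} → i ∈ is → i ↦ j → Pointwise _↦_ is js → j ∈ js
    images-complete (here refl) f (f′ ∷ _) = here (α-injective (ⱽ-trans (ⱽ-sym f) f′))
    images-complete (there i∈)  f (_ ∷ fs) = there (images-complete i∈ f fs)

    -- φ x permutes the simple roots of the two orbits, hence conjugates one orbit product into the other.
    orbit-conjugate : φ x ++ orbit o ≋ orbit o′ ++ φ x
    orbit-conjugate with js , ps , fs ← images (all-orbit o) = G.trans (conjugate fs) (G.∙-congʳ {φ x}
      (permuted (∼bag⇒↭ (unique∧set⇒bag (images-unique (orbit-unique o) fs) (orbit-unique o′)
        (mk⇔ (λ j∈ → ∈-orbit⁺ (All.lookup ps j∈))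
             (λ j∈ → let i , e , f = preimage _ (∈-orbit⁻ j∈) in images-complete (∈-orbit⁺ e) f fs)))) ps))

  -- Equality would make the `k`-th power of the product of the two orbit products trivial with `k`
  -- positive and below its order. The factors appear as `o′`, `o` because one alternating word gets
  -- reversed.
  alternating-distinct : ∀ {o o′} k → fin (suc k) ≤⁺ CoxeterMatrix.m M′ o o′ → 1 ℕ.≤ k →
    ¬ φ (alternating o o′ k) ≋ φ (alternating o′ o k)
  alternating-distinct {o} {o′} k k<m 1≤k e =
    no-order (CoxeterMatrix.m M′ o′ o) (subst (fin (suc k) ≤⁺_) (CoxeterMatrix.symmetric M′ o o′) k<m)
      (order o′ o) k 1≤k ℕ.≤-refl power
    where
    a b : Word n′
    a = alternating o o′ k
    b = alternating o′ o k
    open import Relation.Binary.Reasoning.Setoid G.setoid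
    power : (orbit o′ ++ orbit o) ^ k ≋ []
    power = begin
      (orbit o′ ++ orbit o) ^ k    ≡⟨ φ-^ o′ o k ⟨
      φ ((o′ ∷ o ∷ []) ^ k)        ≡⟨ cong φ (reverse-alternating-++ o o′ k) ⟨
      φ (reverse a ++ b)           ≡⟨ φ-++ (reverse a) b ⟩
      φ (reverse a) ++ φ b         ≈⟨ G.∙-congˡ {φ (reverse a)} e ⟨
      φ (reverse a) ++ φ a         ≡⟨ φ-++ (reverse a) a ⟨
      φ (reverse a ++ a)           ≈⟨ φ-resp (W′.G.inverseˡ a) ⟩
      []                           ∎
    no-order : ∀ ℓ {w} → fin (suc k) ≤⁺ ℓ → HasOrder M w ℓ → ∀ l → 1 ℕ.≤ l → l ℕ.≤ k → ¬ w ^ l ≋ []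
    no-order ∞         _     ord           l p q = ord l p
    no-order (fin _) [ r ] (_ , _ , minimal) l p q = minimal l p (ℕ.<-≤-trans (ℕ.s≤s q) r)

  alternating-positive : ∀ {o o′} k → fin (suc k) ≤⁺ CoxeterMatrix.m M′ o o′ → Positive (alternating o o′ k) o
  alternating-positive {o} {o′} zero    _   = Positive-[] o
  alternating-positive {o} {o′} (suc k) k<m with em {Positive (alternating o o′ (suc k)) o}
  ... | yes p = p
  -- By induction `a` keeps the orbit `o` positive, so `o″` is the letter that spoils it and
  -- `orbit-conjugate` applies. The two sides it equates are the images of `a ++ o ∷ []` and
  -- `o″ ∷ a`, the two alternating words of length `suc k`.
  ... | no ¬p = contradiction (G.sym (G.trans (≡⇒≋ (φ-∷ a o))
                  (G.trans (orbit-conjugate {a} {o} {o″} (alternating-positive k (pred-≤⁺ k<m)) negative)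
                           (≡⇒≋ (cong φ (≡.sym (alternating-cons o o′ k)))))))
                (alternating-distinct (suc k) k<m (ℕ.s≤s ℕ.z≤n))
    where
    a : Word n′
    a = alternating o o′ k
    o″ : Fin n′
    o″ = nextLetter o o′ k
    peeled : ∀ i → φ (alternating o o′ (suc k)) • α i ≡ orbit o″ • φ a • α i
    peeled i = ≡.trans (cong (λ w → φ w • α i) (alternating-cons o o′ k)) (•-++ (orbit o″) (φ a) (α i))
    negative : ∀ i → orb i ≡ o → NonPosⱽ (orbit o″ • φ a • α i)
    negative i e with dichotomy (φ (alternating o o′ (suc k))) i
    ... | inj₁ p = contradiction (NonNegⱽ⇒Positive (alternating o o′ (suc k)) i e p) ¬p
    ... | inj₂ p = subst NonPosⱽ (peeled i) p

  φ-outside : ∀ {x l} β → All (_≢ orb l) x → (φ x • β) l ≈ℝ β l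
  φ-outside β ps = •-outside β (All.concat⁺ (All.map⁺ (All.map outside ps)))
    where
    outside : ∀ {o l} → o ≢ orb l → All (_≢ l) (orbit o)
    outside {o} {l} ne = All.map (λ { e refl → ne (≡.sym e) }) (all-orbit o)

  alternating-letters : ∀ {k} {P : Fin k → Set} {i j} → P i → P j → ∀ l → All P (alternating i j l)
  alternating-letters p q zero    = []
  alternating-letters p q (suc l) = All.++⁺ (alternating-letters q p l) (q ∷ [])

  -- `φ a • α i` is nonnegative by the purely dihedral case, and its support lies in the two orbits,
  -- whose simple roots `φ x` sends to nonnegative vectors.
  Positive-dihedral : ∀ {o o′} → o ≢ o′ → ∀ x k → Positive x o → Positive x o′ →
    fin (suc k) ≤⁺ CoxeterMatrix.m M′ o o′ → Positive (x ++ alternating o o′ k) o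
  Positive-dihedral {o} {o′} _ x k p p′ k<m i e =
    subst NonNegⱽ (≡.sym (≡.trans (cong (_• α i) (φ-++ x a)) (•-++ (φ x) (φ a) (α i))))
      (•-nonNeg (φ x) (alternating-positive k k<m i e) positive-on-support)
    where
    a : Word n′
    a = alternating o o′ k
    positive-on-support : ∀ j → (φ a • α i) j ≈ℝ 0# ⊎ NonNegⱽ (φ x • α j)
    positive-on-support j with orb j ≟ o | orb j ≟ o′
    ... | yes f | _     = inj₂ (p j f)
    ... | no _  | yes f = inj₂ (p′ j f)
    ... | no f  | no f′ = inj₁ (≈-trans (φ-outside (α i) (alternating-letters (f ∘ ≡.sym) (f′ ∘ ≡.sym) k))
                            (≈-reflexive (α-offDiagonal {i} {j} (λ { refl → f e }))))

  reduced-Positive : ∀ x o → W′.Reduced (x ++ o ∷ []) → Positive x o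
  reduced-Positive = W′.positivity em Positive Positive-resp Positive-[] Positive-dihedral

  reflect-orthogonal : ∀ i j → Orthogonal i j → reflect i (-ⱽ α j) ≈ⱽ -ⱽ α j
  reflect-orthogonal i j e = ⱽ-trans (•-neg (i ∷ []) (α j)) (-ⱽ-cong (reflect-fixes i {α j} e))

  product-negates : ∀ w i → AllPairs (λ j i → Orthogonal i j) w → i ∈ w → w • α i ≈ⱽ -ⱽ α i
  product-negates (i ∷ w) i (o ∷ os) (here refl) = ⱽ-trans (reflect-cong i (fixes-orthogonal i o)) (reflect-α i)
  product-negates (j ∷ w) i (o ∷ os) (there i∈) = ⱽ-trans (reflect-cong j (product-negates w i os i∈))
    (reflect-orthogonal j i (≈-trans (B-sym (α i) (α j)) (All.lookup o i∈)))

  orbit-negates : ∀ i → orbit (orb i) • α i ≈ⱽ -ⱽ α i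
  orbit-negates i =
    product-negates (orbit (orb i)) i (orthogonal-list (all-orbit (orb i)) (orbit-unique (orb i))) (∈-orbit⁺ refl)

  -- An ascent makes both sides true. A descent refutes both: s_o negates its simple root in W′, and
  -- the orbit product negates each simple root of the orbit in W.
  sign-agreement : ∀ x i → W′.NonNegⱽ (x W′.• W′.α (orb i)) ⇔ NonNegⱽ (φ x • α i)
  sign-agreement x i with W′.ascent-or-descent x (orb i)
  ... | u , r , inj₁ u≋x = mk⇔
    (λ _ → NonNegⱽ-resp (•-resp (φ-resp u≋x) (α i)) (reduced-Positive u (orb i) r i refl))
    (λ _ → W′.NonNegⱽ-resp (W′.•-resp u≋x (W′.α (orb i))) (W′.reduced-positive u (orb i) r))
  ... | u , r , inj₂ us≋x = mk⇔
    (λ p → contradiction nonPos′ (W′.root-nonzero x (orb i) p))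
    (λ p → contradiction nonPos (root-nonzero (φ x) i p))
    where
    nonPos′ : W′.NonPosⱽ (x W′.• W′.α (orb i))
    nonPos′ = W′.NonNegⱽ-resp (W′.ⱽ-trans (W′.-ⱽ-involutive (u W′.• W′.α (orb i)))
      (W′.-ⱽ-cong (W′.ⱽ-trans (W′.ⱽ-sym (W′.•-snoc-α u (orb i))) (W′.•-resp us≋x (W′.α (orb i))))))
      (W′.reduced-positive u (orb i) r)
    negated : φ x • α i ≈ⱽ -ⱽ (φ u • α i)
    negated = begin
      φ x • α i                          ≈⟨ •-resp (φ-resp us≋x) (α i) ⟨
      φ (u ++ orb i ∷ []) • α i          ≡⟨ cong (_• α i) (φ-∷ u (orb i)) ⟩
      (φ u ++ orbit (orb i)) • α i       ≡⟨ •-++ (φ u) (orbit (orb i)) (α i) ⟩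
      φ u • orbit (orb i) • α i          ≈⟨ •-cong (φ u) (orbit-negates i) ⟩
      φ u • -ⱽ α i                       ≈⟨ •-neg (φ u) (α i) ⟩
      -ⱽ (φ u • α i)                     ∎
      where open ⱽ-Reasoning
    nonPos : NonPosⱽ (φ x • α i)
    nonPos = NonNegⱽ-resp (ⱽ-trans (-ⱽ-involutive (φ u • α i)) (-ⱽ-cong (ⱽ-sym negated))) (reduced-Positive u (orb i) r i refl)

-- Roots and half-spaces up to pointwise equality of vectors

module HalfSpaces (em : ExcludedMiddle 0ℓ) (R : Reals) {n : ℕ} (M : CoxeterMatrix n) where
  open Positivity em R M

  Root : V → Set
  Root = IsRoot em R M

  Half : V → Word n → Set
  Half = HalfSpace em R M

  Root-• : ∀ w {β} → Root β → Root (w • β)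
  Root-• w (v , i , e) = w ++ v , i , ⱽ-trans (•-cong w e) (ⱽ-reflexive (≡.sym (•-++ w v (α i))))

  Root-resp : ∀ {β γ} → β ≈ⱽ γ → Root β → Root γ
  Root-resp e (v , i , f) = v , i , ⱽ-trans (ⱽ-sym e) f

  Half-resp : ∀ {β γ w} → β ≈ⱽ γ → Half β w → Half γ w
  Half-resp {w = w} e (r , p) = Root-resp (•-cong w e) r , NonNegⱽ-resp (•-cong w e) p

  RootsOf-resp : ∀ {L β γ} → β ≈ⱽ γ → RootsOf em R M L β → RootsOf em R M L γ
  RootsOf-resp e (r , p) = Root-resp e r , λ w w∈ → Half-resp {w = w} e (p w w∈)

-- Transport of convex sets, toggles and promotion along φ

module ConvexFolding (em : ExcludedMiddle 0ℓ) (R : Reals) {n n′ : ℕ} {M : CoxeterMatrix n}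
                     {M′ : CoxeterMatrix n′} (folding : IsFolding M M′) (L′ : Word n′ → Set) where
  open FoldedRoots em R folding
  open HalfSpaces em R M
  module H′ = HalfSpaces em R M′

  A : V → Set
  A γ = Root γ × (∀ w → L′ w → Half γ (φ w))

  L : Word n → Set
  L w = ∀ γ → A γ → Half γ w

  L-convex : IsConvex em R M L
  L-convex = A , (λ _ → proj₁) , λ _ → mk⇔ (λ p → p) (λ p → p)

  φ-L : ∀ {w} → L′ w → L (φ w)
  φ-L {w} w∈ γ (_ , p) = p w w∈

  half-space-transfer : ∀ u w i → H′.Half (w W′.• W′.α (orb i)) u ⇔ Half (φ w • α i) (φ u)
  half-space-transfer u w i = mk⇔
    (λ (_ , p) → Root-• (φ u) (φ w , i , ⱽ-refl) , subst NonNegⱽ eq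
      (Equivalence.to (sign-agreement (u ++ w) i) (subst W′.NonNegⱽ (≡.sym eq′) p)))
    (λ (_ , p) → H′.Root-• u (w , orb i , W′.ⱽ-refl) , subst W′.NonNegⱽ eq′
      (Equivalence.from (sign-agreement (u ++ w) i) (subst NonNegⱽ (≡.sym eq) p)))
    where
    eq : φ (u ++ w) • α i ≡ φ u • φ w • α i
    eq = ≡.trans (cong (_• α i) (φ-++ u w)) (•-++ (φ u) (φ w) (α i))
    eq′ : (u ++ w) W′.• W′.α (orb i) ≡ u W′.• w W′.• W′.α (orb i)
    eq′ = W′.•-++ u w (W′.α (orb i))

  -- Each root defining `L′` has the form w α_o. For any `i` in the orbit `o`, the root `φ w • α i`
  -- is positive on φ(L′) and so belongs to `A`; membership of `φ u` in `L` then gives its sign at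
  -- `u`.
  φ-L⁻¹ : IsConvex em R M′ L′ → ∀ u → L (φ u) → L′ u
  φ-L⁻¹ (A′ , A′-roots , L′⇔) u φu∈ = Equivalence.from (L′⇔ u) half
    where
    half : ∀ β → A′ β → H′.Half β u
    half β β∈ with w , o , e ← A′-roots β β∈ with i , refl ← surjective o =
      H′.Half-resp {w = u} (W′.ⱽ-sym e) (Equivalence.from (half-space-transfer u w i)
        (φu∈ (φ w • α i) ((φ w , i , ⱽ-refl) , λ v v∈ → Equivalence.to (half-space-transfer v w i)
          (H′.Half-resp {w = v} e (Equivalence.to (L′⇔ v) v∈ β β∈)))))

  φ-reverse : ∀ u → φ (reverse u) ≋ reverse (φ u)
  φ-reverse u = Algebra.Properties.Group.inverseˡ-unique (coxeterGroup M) (φ (reverse u)) (φ u)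
    (G.trans (≡⇒≋ (≡.sym (φ-++ (reverse u) u))) (φ-resp (W′.G.inverseˡ u)))

  -- `L` contains φ(L′) and lies in every half-space that does, so both conditions reduce to signs
  -- on φ(L′). The word `y` stands for `φ u` only up to `≋`, because toggling letter by letter
  -- produces words that merely represent it.
  fixed-transfer : ∀ u {y} i → y ≋ φ u →
    RootsOf em R M′ L′ (reverse u W′.• W′.α (orb i)) ⇔ RootsOf em R M L (reverse y • α i)
  fixed-transfer u {y} i e = mk⇔
    (λ (_ , p) → (reverse y , i , ⱽ-refl) , λ w w∈ → w∈ (reverse y • α i)
      ((reverse y , i , ⱽ-refl) , λ v v∈ →
        Half-resp {w = φ v} eq (Equivalence.to (half-space-transfer v (reverse u) i) (p v v∈))))
    (λ (_ , p) → (reverse u , orb i , W′.ⱽ-refl) , λ v v∈ →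
      Equivalence.from (half-space-transfer v (reverse u) i)
        (Half-resp {w = φ v} (ⱽ-sym eq) (p (φ v) (φ-L v∈))))
    where
    eq : φ (reverse u) • α i ≈ⱽ reverse y • α i
    eq = •-resp (G.trans (φ-reverse u) (G.⁻¹-cong (G.sym e))) (α i)

  private
    τ : Fin n → Word n → Word n
    τ = toggle em R M L
    τ′ : Fin n′ → Word n′ → Word n′
    τ′ = toggle em R M′ L′

    Fixed′ : Fin n′ → Word n′ → Set
    Fixed′ o u = RootsOf em R M′ L′ (reverse u W′.• W′.α o)

  toggles-fixed : ∀ {o} u {y w} → y ≋ φ u → Fixed′ o u → All (λ i → orb i ≡ o) w → foldr τ y w ≋ φ u
  toggles-fixed u e f []       = e
  toggles-fixed {o} u {y} {i ∷ w} e f (refl ∷ ps)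
    with em {RootsOf em R M L (reverse (foldr τ y w) • α i)} | toggles-fixed u e f ps
  ... | yes _ | rec = rec
  ... | no ¬r | rec = contradiction (Equivalence.to (fixed-transfer u i rec) f) ¬r

  -- The toggles of one orbit do not interfere: s_j fixes α_i for distinct i and j in the orbit.
  toggles-moved : ∀ {o} u {y w} → y ≋ φ u → ¬ Fixed′ o u → All (λ i → orb i ≡ o) w → Unique w →
                  foldr τ y w ≋ w ++ φ u
  toggles-moved u e ¬f []       []     = e
  toggles-moved {o} u {y} {i ∷ w} e ¬f (refl ∷ ps) us@(_ ∷ us′)
    with em {RootsOf em R M L (reverse (foldr τ y w) • α i)} | toggles-moved u e ¬f ps us′
  ... | no _  | rec = G.∙-congˡ {i ∷ []} rec
  ... | yes r | rec = contradiction (Equivalence.from (fixed-transfer u i G.refl) (RootsOf-resp {L} eq r)) ¬f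
    where
    open ⱽ-Reasoning
    fixes : Fixes w (α i)
    fixes = fixes-orthogonal i (AllPairs.head (orthogonal-list (refl ∷ ps) us))
    eq : reverse (foldr τ y w) • α i ≈ⱽ reverse (φ u) • α i
    eq = begin
      reverse (foldr τ y w) • α i               ≈⟨ •-resp (G.⁻¹-cong rec) (α i) ⟩
      reverse (w ++ φ u) • α i                  ≡⟨ cong (_• α i) (reverse-++ w (φ u)) ⟩
      (reverse (φ u) ++ reverse w) • α i        ≡⟨ •-++ (reverse (φ u)) (reverse w) (α i) ⟩
      reverse (φ u) • reverse w • α i           ≈⟨ •-cong (reverse (φ u)) (•-cong (reverse w) fixes) ⟨
      reverse (φ u) • reverse w • w • α i       ≈⟨ •-cong (reverse (φ u)) (reverse-cancels w (α i)) ⟩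
      reverse (φ u) • α i                       ∎

  toggle-orbit : ∀ o u {y} → y ≋ φ u → foldr τ y (orbit o) ≋ φ (τ′ o u)
  toggle-orbit o u e with em {Fixed′ o u}
  ... | yes f = toggles-fixed u e f (all-orbit o)
  ... | no ¬f = toggles-moved u e ¬f (all-orbit o) (orbit-unique o)

  Pro-φ : ∀ is u {y} → y ≋ φ u → Pro em R M L (φ is) y ≋ φ (Pro em R M′ L′ is u)
  Pro-φ []       u     e = e
  Pro-φ (o ∷ is) u {y} e = G.trans (≡⇒≋ (foldr-++ τ y (orbit o) (φ is)))
    (toggle-orbit o (Pro em R M′ L′ is u) (Pro-φ is u e))

  Pro-φ-fold : ∀ is u k → fold (φ u) (Pro em R M L (φ is)) k ≋ φ (fold u (Pro em R M′ L′ is) k)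
  Pro-φ-fold is u zero    = G.refl
  Pro-φ-fold is u (suc k) = Pro-φ is _ (Pro-φ-fold is u k)

  -- The orbits partition the vertices, so listing them one after another repeats nothing and omits
  -- nothing. This makes `φ is` a Coxeter element of W.
  φ-ordering : ∀ {is} → IsOrdering M′ is → IsOrdering M (φ is)
  φ-ordering {is} p = ∼bag⇒↭ (unique∧set⇒bag unique (Unique.allFin⁺ n) (mk⇔ (λ _ → ∈-allFin _) (λ _ → complete _)))
    where
    disjoint : ∀ {o o′} → o ≢ o′ → Disjoint (orbit o) (orbit o′)
    disjoint o≢o′ (i∈ , i∈′) = o≢o′ (≡.trans (≡.sym (∈-orbit⁻ i∈)) (∈-orbit⁻ i∈′))
    unique : Unique (φ is)
    unique = Unique.concat⁺ (All.map⁺ (All.tabulate λ {o} _ → orbit-unique o))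
      (AllPairs.map⁺ (AllPairs.map disjoint
        (↭ₛ.Unique-resp-↭ (≡.setoid (Fin n′)) (↭.↭⇒↭ₛ (↭.↭-sym p)) (Unique.allFin⁺ n′))))
    complete : ∀ i → i ∈ φ is
    complete i = ∈-concatMap⁺ orbit (Any.map (λ { refl → ∈-orbit⁺ refl }) (∈-resp-↭ (↭.↭-sym p) (∈-allFin (orb i))))

proposition1p13 : (em : ExcludedMiddle 0ℓ) (R : Reals) {n n′ : ℕ}
    (M : CoxeterMatrix n) (M′ : CoxeterMatrix n′) → IsFolding M M′ →
    IsFuturistic em R M → IsFuturistic em R M′
proposition1p13 em R M M′ folding futuristic L′ (w , w∈L′) convex _ _ is ordering _ u (K , 1≤K , periodic) =
  -- The Coxeter element of W is the word `φ is` itself, listed by its own ordering; the period `K`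
  -- of `u` is also a period of `φ u`.
  φ-L⁻¹ convex u (futuristic L (φ w , φ-L w∈L′) L-convex (φ is) (φ is , φ-ordering ordering , G.refl)
    (φ is) (φ-ordering ordering) G.refl (φ u)
    (K , 1≤K , G.trans (Pro-φ-fold is u K) (φ-resp periodic)))
  where
  open FoldedRoots em R folding
  open ConvexFolding em R folding L′
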